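{- If there is a subquadratic-time algorithm for finding the median of a sparse unweighted undirected graph, then the Hitting Set Conjecture is false.
   Context: In an undirected graph $G=(V,E)$ with shortest path distance $d$, the median is the node $c$ that minimizes the sum of distances $\sum_{v\in V,\,v\ne c} d(c,v)$ to all other nodes; an algorithm for the Median problem outputs the quantity $\min_{c\in V}\sum_{v\in V, v\ne c} d(c,v)$. A sparse graph is a graph with $n$ nodes and $O(n)$ edges. Subquadratic time means time $O(n^{2-\varepsilon})$ for some $\varepsilon>0$. Running times are in the standard word-RAM model with $O(\log n)$-bit words. Hitting Set (HS) Conjecture: there is no $\varepsilon>0$ such that for all $c\ge 1$ there is an algorithm that, given two lists of $n$ subsets of a universe $U$ of size $c\log n$, decides in $O(n^{2-\varepsilon})$ time whether there is a set in the first list that intersects every set in the second list. -}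

module Defs where

open import Data.Bool.Base using (Bool; true; false; if_then_else_; _∧_; _∨_; _xor_)
open import Data.Fin.Base using (Fin; toℕ) renaming (_<_ to _<ᶠ_)
open import Data.Fin.Properties using () renaming (_≟_ to _≟ᶠ_)
open import Data.Fin.Subset using (Subset; Nonempty; _∩_)
open import Data.Integer.Base using (∣_∣)
open import Data.List.Base using (List; []; _∷_; _++_; map; concatMap; length; filter; allFin)
open import Data.List.Membership.Propositional using (_∈_)
open import Data.List.Relation.Unary.All using (All)
open import Data.List.Relation.Unary.Unique.Propositional using (Unique)
open import Data.Nat.Base
open import Data.Nat.ListAction using (sum)
open import Data.Nat.Logarithm using (⌈log₂_⌉)
open import Data.Nat.Properties using (_≟_; m^n≢0)
open import Data.Product.Base using (_×_; _,_; proj₁; proj₂; Σ; ∃; ∃-syntax)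
open import Data.Rational.Base using (ℚ; 0ℚ; ↥_; ↧ₙ_) renaming (_<_ to _<ℚ_)
open import Data.Sum.Base using (_⊎_)
open import Data.Vec.Base using (Vec; toList)
import Data.Vec.Relation.Unary.All as Vec
import Data.Vec.Relation.Unary.Any as Vec
open import Relation.Binary.PropositionalEquality using (_≡_; _≢_)
open import Relation.Nullary.Decidable.Core using (does; ¬?)
open import Relation.Nullary.Negation.Core using (¬_)

-- Word RAM programs use finitely many registers (those named in the
-- program) and a random-access memory, all holding words.

data Op : Set where
  add sub mul div mod and or xor shl shr less equal : Op

-- The first argument bounds the number of bits examined.
bitwise : (Bool → Bool → Bool) → ℕ → ℕ → ℕ → ℕ
bitwise f zero    x y = 0
bitwise f (suc b) x y =
  (if f (x % 2 ≡ᵇ 1) (y % 2 ≡ᵇ 1) then 1 else 0) + 2 * bitwise f b (x / 2) (y / 2)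

-- Subtraction is truncated at 0, and dividing by 0 gives 0.  x ⊔ y bits
-- are enough for the bitwise operations, since x < 2 ^ x.
⟦_⟧ : Op → ℕ → ℕ → ℕ
⟦ add   ⟧ x y       = x + y
⟦ sub   ⟧ x y       = x ∸ y
⟦ mul   ⟧ x y       = x * y
⟦ div   ⟧ x zero    = 0
⟦ div   ⟧ x (suc y) = x / suc y
⟦ mod   ⟧ x zero    = 0
⟦ mod   ⟧ x (suc y) = x % suc y
⟦ and   ⟧ x y       = bitwise _∧_ (x ⊔ y) x y
⟦ or    ⟧ x y       = bitwise _∨_ (x ⊔ y) x y
⟦ xor   ⟧ x y       = bitwise _xor_ (x ⊔ y) x y
⟦ shl   ⟧ x y       = x * 2 ^ y
⟦ shr   ⟧ x y       = _/_ x (2 ^ y) {{m^n≢0 2 y}}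
⟦ less  ⟧ x y       = if x <ᵇ y then 1 else 0
⟦ equal ⟧ x y       = if x ≡ᵇ y then 1 else 0

Register : Set
Register = ℕ

infixr 5 _⨾_

data Program : Set where
  skip            : Program
  const           : (r : Register) (v : ℕ) → Program                 -- r := v
  arith           : (r : Register) (o : Op) (a b : Register) → Program  -- r := a o b
  load            : (r a : Register) → Program                       -- r := mem[a]
  store           : (a r : Register) → Program                       -- mem[a] := r
  _⨾_             : Program → Program → Program
  if≢0_then_else_ : Register → Program → Program → Program
  while≢0_loop_   : Register → Program → Program

record State : Set where
  constructor state
  field
    reg : ℕ → ℕ
    mem : ℕ → ℕ

open State public

_[_↦_] : (ℕ → ℕ) → ℕ → ℕ → (ℕ → ℕ)
(f [ i ↦ v ]) j = if does (i ≟ j) then v else f j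

-- Exec w P σ t τ: with w-bit words, P started in σ halts in τ after t
-- unit-cost steps (instructions and tests).  There is no rule for writing
-- a value ≥ 2 ^ w into a register, so a computation that overflows gets
-- stuck.  Modular arithmetic on w-bit words can be simulated without
-- overflow on O(w)-bit words at constant-factor cost.
data Exec (w : ℕ) : Program → State → ℕ → State → Set where

  skip : ∀ {σ} → Exec w skip σ 1 σ

  const : ∀ {σ r v} → v < 2 ^ w →
          Exec w (const r v) σ 1 (state (reg σ [ r ↦ v ]) (mem σ))

  arith : ∀ {σ r o a b} → let v = ⟦ o ⟧ (reg σ a) (reg σ b) in v < 2 ^ w →
          Exec w (arith r o a b) σ 1 (state (reg σ [ r ↦ v ]) (mem σ))

  load  : ∀ {σ r a} → let v = mem σ (reg σ a) in v < 2 ^ w →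
          Exec w (load r a) σ 1 (state (reg σ [ r ↦ v ]) (mem σ))

  store : ∀ {σ a r} →
          Exec w (store a r) σ 1 (state (reg σ) (mem σ [ reg σ a ↦ reg σ r ]))

  seq   : ∀ {P Q ρ σ τ t u} → Exec w P ρ t σ → Exec w Q σ u τ →
          Exec w (P ⨾ Q) ρ (t + u) τ

  if-nonzero : ∀ {r P Q σ τ t} → reg σ r ≢ 0 → Exec w P σ t τ →
               Exec w (if≢0 r then P else Q) σ (suc t) τ

  if-zero    : ∀ {r P Q σ τ t} → reg σ r ≡ 0 → Exec w Q σ t τ →
               Exec w (if≢0 r then P else Q) σ (suc t) τ

  while-stop : ∀ {r P σ} → reg σ r ≡ 0 → Exec w (while≢0 r loop P) σ 1 σ

  while-step : ∀ {r P ρ σ τ t u} → reg ρ r ≢ 0 →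
               Exec w P ρ t σ → Exec w (while≢0 r loop P) σ u τ →
               Exec w (while≢0 r loop P) ρ (suc (t + u)) τ

-- The input occupies memory from address 0 on; all else is zero.
contents : List ℕ → ℕ → ℕ
contents []       i       = 0
contents (x ∷ xs) zero    = x
contents (x ∷ xs) (suc i) = contents xs i

initial : List ℕ → State
initial xs = state (λ _ → 0) (contents xs)

output : State → ℕ
output σ = reg σ 0

record Problem : Set₁ where
  field
    Instance : Set
    size     : Instance → ℕ
    encode   : Instance → List ℕ
    IsAnswer : Instance → ℕ → Set

-- t ≤ C · n ^ (2 - ε) for ε = p / q and n ≥ 1, i.e.
-- t ^ q · n ^ p ≤ (C · n ²) ^ q.
TimeBound : (ε : ℚ) (C n t : ℕ) → Set
TimeBound ε C n t = t ^ (↧ₙ ε) * n ^ ∣ ↥ ε ∣ ≤ (C * n ^ 2) ^ (↧ₙ ε)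

-- A word RAM program solves the problem in time O(n ^ (2 - ε)) using
-- words of k · (1 + ⌈log₂ n⌉) = O(log n) bits.
SolvableInTime2- : ℚ → Problem → Set
SolvableInTime2- ε Π =
  ∃[ P ] ∃[ k ] ∃[ C ] ∀ (I : Instance) → 1 ≤ size I →
    ∃[ t ] ∃[ τ ] Exec (k * suc ⌈log₂ size I ⌉) P (initial (encode I)) t τ
                × IsAnswer I (output τ)
                × TimeBound ε C (size I) t
  where open Problem Π

-- Restricting to rational ε loses nothing: the bound for ε implies the
-- bound for every smaller positive ε.
Subquadratic : Problem → Set
Subquadratic Π = ∃[ ε ] 0ℚ <ℚ ε × SolvableInTime2- ε Π

-- A simple undirected graph on the vertices Fin n, with every edge listed
-- once, smaller endpoint first.
record Graph (n : ℕ) : Set where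
  field
    edges   : List (Fin n × Fin n)
    ordered : All (λ e → proj₁ e <ᶠ proj₂ e) edges
    unique  : Unique edges

  Adjacent : Fin n → Fin n → Set
  Adjacent u v = (u , v) ∈ edges ⊎ (v , u) ∈ edges

  data Walk : ℕ → Fin n → Fin n → Set where
    []  : ∀ {u} → Walk 0 u u
    _∷_ : ∀ {k u v x} → Adjacent u v → Walk k v x → Walk (suc k) u x

  Connected : Set
  Connected = ∀ u v → ∃[ k ] Walk k u v

  IsDistance : Fin n → Fin n → ℕ → Set
  IsDistance u v k = Walk k u v × (∀ l → Walk l u v → k ≤ l)

  IsDistanceSum : Fin n → ℕ → Set
  IsDistanceSum c x = Σ (Fin n → ℕ) λ d → (∀ v → IsDistance c v (d v)) ×
    x ≡ sum (map d (filter (λ v → ¬? (v ≟ᶠ c)) (allFin n)))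

  IsMedianValue : ℕ → Set
  IsMedianValue x = (∃[ c ] IsDistanceSum c x) × (∀ c y → IsDistanceSum c y → x ≤ y)

-- Connectedness makes all the distances finite.
record SparseGraph (s : ℕ) : Set where
  field
    n         : ℕ
    graph     : Graph n
  open Graph graph public
  field
    connected : Connected
    sparse    : length edges ≤ s * n

Median : ℕ → Problem
Median s = record
  { Instance = SparseGraph s
  ; size     = n
  ; encode   = λ G → n G ∷ length (edges G) ∷
                     concatMap (λ (u , v) → toℕ u ∷ toℕ v ∷ []) (edges G)
  ; IsAnswer = IsMedianValue
  }
  where open SparseGraph

-- O(n) edges means at most s · n edges for a constant s, on which both the
-- algorithm and ε may depend.
SubquadraticSparseMedian : Set
SubquadraticSparseMedian = ∀ s → Subquadratic (Median s)

record SetLists (c : ℕ) : Set where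
  field
    n : ℕ

  universeSize : ℕ
  universeSize = c * ⌈log₂ n ⌉

  field
    A B : Vec (Subset universeSize) n

  HasHittingSet : Set
  HasHittingSet = Vec.Any (λ a → Vec.All (λ b → Nonempty (a ∩ b)) B) A

-- Each set is given by its characteristic vector, one word per bit.
HittingSet : ℕ → Problem
HittingSet c = record
  { Instance = SetLists c
  ; size     = n
  ; encode   = λ I → n I ∷ universeSize I ∷ bits (A I) ++ bits (B I)
  ; IsAnswer = λ I x → (HasHittingSet I × x ≡ 1) ⊎ (¬ HasHittingSet I × x ≡ 0)
  }
  where
  open SetLists
  bits : ∀ {m d} → Vec (Subset d) m → List ℕ
  bits Ss = concatMap (λ S → map (λ b → if b then 1 else 0) (toList S)) (toList Ss)

-- Integer c suffice, since a universe may be padded with elements lying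
-- in none of the sets.
HittingSetConjecture : Set
HittingSetConjecture =
  ¬ (∃[ ε ] 0ℚ <ℚ ε × (∀ c → 1 ≤ c → SolvableInTime2- ε (HittingSet c)))

{-# OPTIONS --safe #-}

-- Each set of either list becomes a vertex, adjacent for every element j to
-- leaf 0 j if it contains j, and otherwise to leaf 1 j (first list) or leaf 2 j
-- (second list).  Three hubs are adjacent to all sets of the first list; hub 0
-- is adjacent to all leaves as well, and hubs 1 and 2 have so many pendant
-- neighbours that the median must lie in the first list.  A set of the first
-- list is at distance 2 from the sets of the second list that it meets and 3
-- from the others, and the sum of its other distances is the same for all, so
-- the median value tells whether some set meets every set of the second list.
-- The pendant vertices also make the graph sparse, with O(n log n) vertices;
-- the logarithmic factor is absorbed by a smaller ε.
module Submission where

open import Defs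
open import Algebra.Properties.CommutativeMonoid.Sum using (sum; sum-cong-≗; ∑-comm)
open import Data.Bool.Base using (Bool; true; false; if_then_else_; T)
open import Data.Empty using (⊥-elim)
open import Data.Fin.Base using (Fin; zero; suc; toℕ; _↑ˡ_; _↑ʳ_; combine; remQuot; fromℕ<; splitAt; join)
open import Data.Fin.Patterns
open import Data.Fin.Properties using (toℕ-injective; toℕ<n; toℕ-fromℕ<; toℕ-↑ˡ; toℕ-↑ʳ; toℕ-combine; +↔⊎; *↔×; splitAt-join; join-splitAt; remQuot-combine; combine-remQuot) renaming (_≟_ to _≟ᶠ_)
open import Data.Fin.Subset using (Subset; Nonempty; _∩_)
open import Data.Fin.Subset.Properties using (nonempty?; x∈p∩q⁺; x∈p∩q⁻)
import Data.Integer.Base as ℤ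
open import Data.List.Base using (List; []; _∷_; _++_; map; filter; allFin; concatMap; length; tabulate)
open import Data.List.Membership.Propositional using (_∈_)
open import Data.List.Membership.Propositional.Properties using (∈-map⁺; ∈-map⁻; ∈-allFin; ∈-concatMap⁺)
open import Data.List.Properties using (map-tabulate; map-++; length-++; length-map; length-tabulate; ++-assoc; ++-identityʳ; concatMap-++)
import Data.List.Relation.Unary.All as All
import Data.List.Relation.Unary.All.Properties as All
import Data.List.Relation.Unary.AllPairs as AllPairs
import Data.List.Relation.Unary.AllPairs.Properties as AllPairs
import Data.List.Relation.Unary.Any as Any
open import Data.List.Relation.Unary.Unique.Propositional using (Unique)
import Data.List.Relation.Unary.Unique.Propositional.Properties as Unique
open import Data.Maybe.Base using (Maybe; just; nothing)
open import Data.Maybe.Properties using (just-injective)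
open import Data.Nat.Base
open import Data.Nat.Coprimality using (1-coprimeTo)
open import Data.Nat.Divisibility using (n∣m*n)
open import Data.Nat.DivMod using (m≡m%n+[m/n]*n; m%n<n; m<n⇒m%n≡m; [m+kn]%n≡m%n; m/n≤m; m/n*n≤m; m*n/n≡m; m<n⇒m/n≡0; +-distrib-/-∣ˡ)
open import Data.Nat.Induction using (<-rec)
open import Data.Nat.ListAction using () renaming (sum to sumᴸ)
open import Data.Nat.Logarithm using (⌈log₂_⌉; ⌈log₂⌉-mono-≤; ⌈log₂2^n⌉≡n; ⌈log₂⌈n/2⌉⌉≡⌈log₂n⌉∸1)
open import Data.Nat.Properties
open import Data.Nat.Tactic.RingSolver using (solve-∀)
open import Data.Product.Base using (_×_; _,_; proj₁; proj₂; Σ; ∃; ∃-syntax; map₁)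
open import Data.Rational.Base using (ℚ; mkℚ; *<*; 0ℚ; ↥_) renaming (_<_ to _<ℚ_)
open import Data.Sum.Base using (_⊎_; inj₁; inj₂; [_,_]′)
open import Data.Sum.Function.Propositional using (_⊎-↔_)
open import Data.Unit.Base using (⊤; tt)
open import Data.Vec.Base as Vec using (Vec; []; _∷_; lookup; toList) renaming (_[_]≔_ to _[_]:=_)
open import Data.Vec.Properties using (lookup∘updateAt; lookup∘updateAt′; lookup-replicate; lookup-++ˡ; lookup-++ʳ; toList-++; length-toList; []=⇒lookup; lookup⇒[]=)
import Data.Vec.Relation.Unary.All as Vec
import Data.Vec.Relation.Unary.All.Properties as VecAll
import Data.Vec.Relation.Unary.Any as Vec
import Data.Vec.Relation.Unary.Any.Properties as VecAny
open import Function.Base using (_∘_; id)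
open import Function.Bundles using (_↔_; Inverse)
open import Function.Construct.Composition using (_↔-∘_)
open import Function.Construct.Identity using (↔-id)
open import Relation.Binary.PropositionalEquality
open import Relation.Nullary.Decidable using (Dec; yes; no; does; ¬?; _×-dec_; True; toWitness; dec-true; dec-false; decidable-stable)
open import Relation.Nullary.Negation.Core using (¬_; contradiction)
open import Relation.Unary using (Decidable)

-- Word RAM programs

-- The pendants hang from two hubs because one would not do: a single such hub is a step closer to
-- each pendant than any set is and would become the median itself. Of two hubs of equal weight,
-- each is at distance 1 from one half of the pendants and 3 from the other, the same total as
-- distance 2 from all, so it gains nothing there and loses elsewhere. Exact distances are computed
-- only from the first list. For every other vertex a lower bound suffices, and it comes from any
-- function that vanishes there and changes by at most one along each edge. The program for the
-- median is a black box that expects zero registers and a memory holding nothing but its input. The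
-- reduction therefore rewrites its own input in place, so that no stale cell survives, and runs the
-- black box on fresh registers, keeping the threshold in a register out of its reach. Since
-- overflow blocks execution instead of wrapping around, a run on short words is also a run on
-- longer ones; this lets both parts share one word size.

[↦]-hit : ∀ f i v → (f [ i ↦ v ]) i ≡ v
[↦]-hit f i v rewrite dec-true (i ≟ i) refl = refl

[↦]-miss : ∀ f {i j} v → i ≢ j → (f [ i ↦ v ]) j ≡ f j
[↦]-miss f {i} {j} v i≢j rewrite dec-false (i ≟ j) i≢j = refl

[↦]-cong : ∀ {f g} i v → f ≗ g → f [ i ↦ v ] ≗ g [ i ↦ v ]
[↦]-cong {f} {g} i v f≗g j with i ≟ j
... | yes refl = trans ([↦]-hit f i v) (sym ([↦]-hit g i v))
... | no i≢j = trans ([↦]-miss f v i≢j) (trans (f≗g j) (sym ([↦]-miss g v i≢j)))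

Exec-weaken : ∀ {w w′ P σ t τ} → w ≤ w′ → Exec w P σ t τ → Exec w′ P σ t τ
Exec-weaken w≤ skip = skip
Exec-weaken w≤ (const v<) = const (<-≤-trans v< (^-monoʳ-≤ 2 w≤))
Exec-weaken w≤ (arith v<) = arith (<-≤-trans v< (^-monoʳ-≤ 2 w≤))
Exec-weaken w≤ (load v<) = load (<-≤-trans v< (^-monoʳ-≤ 2 w≤))
Exec-weaken w≤ store = store
Exec-weaken w≤ (seq e f) = seq (Exec-weaken w≤ e) (Exec-weaken w≤ f)
Exec-weaken w≤ (if-nonzero r e) = if-nonzero r (Exec-weaken w≤ e)
Exec-weaken w≤ (if-zero r e) = if-zero r (Exec-weaken w≤ e)
Exec-weaken w≤ (while-stop r) = while-stop r
Exec-weaken w≤ (while-step r e f) = while-step r (Exec-weaken w≤ e) (Exec-weaken w≤ f)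

-- Running a program on renamed registers

shift : ℕ → Program → Program
shift s skip = skip
shift s (const r v) = const (s + r) v
shift s (arith r o a b) = arith (s + r) o (s + a) (s + b)
shift s (load r a) = load (s + r) (s + a)
shift s (store a r) = store (s + a) (s + r)
shift s (P ⨾ Q) = shift s P ⨾ shift s Q
shift s (if≢0 r then P else Q) = if≢0 s + r then shift s P else shift s Q
shift s (while≢0 r loop P) = while≢0 s + r loop shift s P

-- The graph is written cell by cell, so its memory is known only up to `≗`; hence the pointwise
-- `mems`. The registers below `s` are left to the caller.
record Shifted (s : ℕ) (σ σ′ : State) : Set where
  field
    regs : ∀ r → reg σ′ (s + r) ≡ reg σ r
    mems : mem σ′ ≗ mem σ

open Shifted

SameBelow : ℕ → State → State → Set
SameBelow s σ σ′ = ∀ r → r < s → reg σ r ≡ reg σ′ r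

Shifted-set : ∀ {s σ σ′ v v′} r → v′ ≡ v → Shifted s σ σ′ →
              Shifted s (state (reg σ [ r ↦ v ]) (mem σ)) (state (reg σ′ [ s + r ↦ v′ ]) (mem σ′))
Shifted-set {s} {σ} {σ′} {v} r refl sh .regs q with r ≟ q
... | yes refl = trans ([↦]-hit (reg σ′) (s + r) v) (sym ([↦]-hit (reg σ) r v))
... | no r≢q = trans ([↦]-miss (reg σ′) v (λ e → r≢q (+-cancelˡ-≡ s r q e)))
                     (trans (regs sh q) (sym ([↦]-miss (reg σ) v r≢q)))
Shifted-set r refl sh .mems = mems sh

SameBelow-set : ∀ {s} σ r v → SameBelow s σ (state (reg σ [ s + r ↦ v ]) (mem σ))
SameBelow-set {s} σ r v q q<s =
  sym ([↦]-miss (reg σ) v (≢-sym (<⇒≢ (<-≤-trans q<s (m≤m+n s r)))))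

SameBelow-trans : ∀ {s ρ σ τ} → SameBelow s ρ σ → SameBelow s σ τ → SameBelow s ρ τ
SameBelow-trans p q r r< = trans (p r r<) (q r r<)

Shifted-store : ∀ {s σ σ′} a r → Shifted s σ σ′ →
  Shifted s (state (reg σ) (mem σ [ reg σ a ↦ reg σ r ]))
            (state (reg σ′) (mem σ′ [ reg σ′ (s + a) ↦ reg σ′ (s + r) ]))
Shifted-store a r sh .regs = regs sh
Shifted-store {s} {σ} a r sh .mems i rewrite regs sh a | regs sh r = [↦]-cong (reg σ a) (reg σ r) (mems sh) i

-- The renamed program touches only registers from `s` on, so the caller's registers keep their
-- values. With `s` equal to `#regs` this preserves the threshold during the call.
shift-Exec : ∀ {w s P σ t τ} σ′ → Exec w P σ t τ → Shifted s σ σ′ →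
             ∃[ τ′ ] Exec w (shift s P) σ′ t τ′ × Shifted s τ τ′ × SameBelow s σ′ τ′
shift-Exec σ′ skip sh = σ′ , skip , sh , λ _ _ → refl
shift-Exec σ′ (const {r = r} {v} v<) sh =
  _ , const v< , Shifted-set r refl sh , SameBelow-set σ′ r v
shift-Exec {w} {s} σ′ (arith {σ} {r} {o} {a} {b} v<) sh =
  _ , arith (subst (_< 2 ^ w) (sym eq) v<) , Shifted-set r eq sh , SameBelow-set σ′ r _
  where
  eq : ⟦ o ⟧ (reg σ′ (s + a)) (reg σ′ (s + b)) ≡ ⟦ o ⟧ (reg σ a) (reg σ b)
  eq = cong₂ ⟦ o ⟧ (regs sh a) (regs sh b)
shift-Exec {w} {s} σ′ (load {σ} {r} {a} v<) sh =
  _ , load (subst (_< 2 ^ w) (sym eq) v<) , Shifted-set r eq sh , SameBelow-set σ′ r _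
  where
  eq : mem σ′ (reg σ′ (s + a)) ≡ mem σ (reg σ a)
  eq = trans (cong (mem σ′) (regs sh a)) (mems sh _)
shift-Exec σ′ (store {a = a} {r}) sh = _ , store , Shifted-store a r sh , λ _ _ → refl
shift-Exec σ′ (seq e f) sh with shift-Exec σ′ e sh
... | ρ′ , e′ , sh₁ , same₁ with shift-Exec ρ′ f sh₁
... | τ′ , f′ , sh₂ , same₂ = τ′ , seq e′ f′ , sh₂ , SameBelow-trans {ρ = σ′} {ρ′} {τ′} same₁ same₂
shift-Exec σ′ (if-nonzero {r = r} r≢0 e) sh with shift-Exec σ′ e sh
... | τ′ , e′ , sh′ , same = τ′ , if-nonzero (λ z → r≢0 (trans (sym (regs sh r)) z)) e′ , sh′ , same
shift-Exec σ′ (if-zero {r = r} r≡0 e) sh with shift-Exec σ′ e sh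
... | τ′ , e′ , sh′ , same = τ′ , if-zero (trans (regs sh r) r≡0) e′ , sh′ , same
shift-Exec σ′ (while-stop {r = r} r≡0) sh =
  σ′ , while-stop (trans (regs sh r) r≡0) , sh , λ _ _ → refl
shift-Exec σ′ (while-step {r = r} r≢0 e f) sh with shift-Exec σ′ e sh
... | ρ′ , e′ , sh₁ , same₁ with shift-Exec ρ′ f sh₁
... | τ′ , f′ , sh₂ , same₂ =
  τ′ , while-step (λ z → r≢0 (trans (sym (regs sh r)) z)) e′ f′ , sh₂
     , SameBelow-trans {ρ = σ′} {ρ′} {τ′} same₁ same₂

-- Blocks and loops on sixteen named registers

Mem : Set
Mem = ℕ → ℕ

#regs : ℕ
#regs = 16

Regs : Set
Regs = Vec ℕ #regs

-- `high` keeps the registers from `#regs` on at zero: in them the renamed median program finds its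
-- initial state.
record Represents (vs : Regs) (m : Mem) (σ : State) : Set where
  field
    low  : ∀ r → reg σ (toℕ r) ≡ lookup vs r
    high : ∀ r → reg σ (#regs + r) ≡ 0
    mem≡ : mem σ ≡ m

open Represents public

Reg : Set
Reg = Fin #regs

data Instr : Set where
  const : Reg → ℕ → Instr
  arith : Reg → Op → Reg → Reg → Instr
  load  : Reg → Reg → Instr
  store : Reg → Reg → Instr

instr : Instr → Program
instr (const r v) = const (toℕ r) v
instr (arith r o a b) = arith (toℕ r) o (toℕ a) (toℕ b)
instr (load r a) = load (toℕ r) (toℕ a)
instr (store a r) = store (toℕ a) (toℕ r)

block : List Instr → Program
block [] = skip
block (i ∷ is) = instr i ⨾ block is

stepR : Instr → Regs → Mem → Regs
stepR (const r v) vs m = vs [ r ]:= v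
stepR (arith r o a b) vs m = vs [ r ]:= ⟦ o ⟧ (lookup vs a) (lookup vs b)
stepR (load r a) vs m = vs [ r ]:= m (lookup vs a)
stepR (store a r) vs m = vs

stepM : Instr → Regs → Mem → Mem
stepM (store a r) vs m = m [ lookup vs a ↦ lookup vs r ]
stepM _ vs m = m

module _ (w : ℕ) where

  Fits : Instr → Regs → Mem → Set
  Fits (const r v) vs m = v < 2 ^ w
  Fits (arith r o a b) vs m = ⟦ o ⟧ (lookup vs a) (lookup vs b) < 2 ^ w
  Fits (load r a) vs m = m (lookup vs a) < 2 ^ w
  Fits (store a r) vs m = ⊤

  -- Symbolic execution: on a concrete block this unfolds to one word-size condition per
  -- instruction, followed by the postcondition on the computed registers and memory, which is then
  -- often closed by `refl`.
  BlockFits : (Regs → Mem → Set) → List Instr → Regs → Mem → Set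
  BlockFits Q [] vs m = Q vs m
  BlockFits Q (i ∷ is) vs m = Fits i vs m × BlockFits Q is (stepR i vs m) (stepM i vs m)

  Runs : Program → ℕ → (Regs → Mem → Set) → Regs → Mem → Set
  Runs P T Q vs m = ∀ σ → Represents vs m σ →
    ∃[ t ] ∃[ τ ] Exec w P σ t τ × t ≤ T ×
    ∃[ vs′ ] ∃[ m′ ] Represents vs′ m′ τ × Q vs′ m′

module _ {w : ℕ} where

  Represents-set : ∀ {vs m σ v v′} r → v ≡ v′ → Represents vs m σ →
                   Represents (vs [ r ]:= v′) m (state (reg σ [ toℕ r ↦ v ]) (mem σ))
  Represents-set {vs} {σ = σ} {v} r refl rep .low q with r ≟ᶠ q
  ... | yes refl = trans ([↦]-hit (reg σ) (toℕ r) v) (sym (lookup∘updateAt r vs))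
  ... | no r≢q = trans ([↦]-miss (reg σ) v (λ e → r≢q (toℕ-injective e)))
                       (trans (low rep q) (sym (lookup∘updateAt′ q r (≢-sym r≢q) vs)))
  Represents-set {σ = σ} {v} r refl rep .high q =
    trans ([↦]-miss (reg σ) v (<⇒≢ (<-≤-trans (toℕ<n r) (m≤m+n #regs q)))) (high rep q)
  Represents-set r refl rep .mem≡ = mem≡ rep

  run-instr : ∀ {vs m} i σ → Fits w i vs m → Represents vs m σ →
              ∃[ τ ] Exec w (instr i) σ 1 τ × Represents (stepR i vs m) (stepM i vs m) τ
  run-instr (const r v) σ fits rep = _ , const fits , Represents-set r refl rep
  run-instr (arith r o a b) σ fits rep =
    _ , arith (subst (_< 2 ^ w) (sym eq) fits) , Represents-set r eq rep
    where eq = cong₂ ⟦ o ⟧ (low rep a) (low rep b)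
  run-instr (load r a) σ fits rep =
    _ , load (subst (_< 2 ^ w) (sym eq) fits) , Represents-set r eq rep
    where eq = cong₂ (λ f x → f x) (mem≡ rep) (low rep a)
  run-instr {vs} (store a r) σ fits rep = _ , store , record
    { low = low rep ; high = high rep
    ; mem≡ = trans (cong₂ (λ x v → mem σ [ x ↦ v ]) (low rep a) (low rep r))
                   (cong (_[ lookup vs a ↦ lookup vs r ]) (mem≡ rep)) }

  run-block : ∀ {Q vs m} is → BlockFits w Q is vs m → Runs w (block is) (suc (length is)) Q vs m
  run-block [] q σ rep = 1 , σ , skip , ≤-refl , _ , _ , rep , q
  run-block (i ∷ is) (fits , rest) σ rep with run-instr i σ fits rep
  ... | ρ , e , rep₁ with run-block is rest ρ rep₁
  ... | t , τ , f , t≤ , fin = suc t , τ , seq e f , s≤s t≤ , fin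

  run-seq : ∀ {P P′ T T′ Q R vs m} → Runs w P T Q vs m →
            (∀ vs′ m′ → Q vs′ m′ → Runs w P′ T′ R vs′ m′) → Runs w (P ⨾ P′) (T + T′) R vs m
  run-seq run next σ rep with run σ rep
  ... | t , ρ , e , t≤ , vs′ , m′ , rep₁ , q with next vs′ m′ q ρ rep₁
  ... | u , τ , f , u≤ , fin = t + u , τ , seq e f , +-mono-≤ t≤ u≤ , fin

  run-map : ∀ {P T Q R vs m} → (∀ {vs m} → Q vs m → R vs m) → Runs w P T Q vs m → Runs w P T R vs m
  run-map f run σ rep with run σ rep
  ... | t , τ , e , t≤ , vs′ , m′ , rep′ , q = t , τ , e , t≤ , vs′ , m′ , rep′ , f q

  -- The invariant is indexed by the number of rounds left, which is also the value of the loop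
  -- register, so termination is structural. A round costs its body and one test; the outer `suc` is
  -- the final test.
  run-while : ∀ {r P T} (Inv : ℕ → Regs → Mem → Set) →
              (∀ j {vs m} → Inv j vs m → lookup vs r ≡ j) →
              (∀ j {vs m} → Inv (suc j) vs m → Runs w P T (Inv j) vs m) →
              ∀ j {vs m} → Inv j vs m → Runs w (while≢0 (toℕ r) loop P) (suc (j * suc T)) (Inv 0) vs m
  run-while Inv count body zero inv σ rep =
    1 , σ , while-stop (trans (low rep _) (count 0 inv)) , ≤-refl , _ , _ , rep , inv
  run-while {T = T} Inv count body (suc j) inv σ rep with body j inv σ rep
  ... | t , ρ , e , t≤ , vs′ , m′ , rep₁ , inv₁ with run-while Inv count body j inv₁ ρ rep₁
  ... | u , τ , f , u≤ , fin =
    suc (t + u) , τ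
    , while-step (λ z → 1+n≢0 (trans (sym (count (suc j) inv)) (trans (sym (low rep _)) z))) e f
    , bound , fin
    where
    bound : suc (t + u) ≤ suc (suc T + j * suc T)
    bound = s≤s (≤-trans (+-mono-≤ t≤ u≤) (≤-reflexive (+-suc T (j * suc T))))

initial-represents : ∀ xs → Represents (Vec.replicate #regs 0) (contents xs) (initial xs)
initial-represents xs = record
  { low = λ r → sym (lookup-replicate r 0) ; high = λ _ → refl ; mem≡ = refl }

-- Distance sums in graphs

∑ : ∀ {n} → (Fin n → ℕ) → ℕ
∑ = sum +-0-commutativeMonoid

∑-cong : ∀ {n} {f g : Fin n → ℕ} → f ≗ g → ∑ f ≡ ∑ g
∑-cong = sum-cong-≗ +-0-commutativeMonoid

∑-mono-≤ : ∀ {n} {f g : Fin n → ℕ} → (∀ i → f i ≤ g i) → ∑ f ≤ ∑ g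
∑-mono-≤ {zero} f≤g = z≤n
∑-mono-≤ {suc n} f≤g = +-mono-≤ (f≤g zero) (∑-mono-≤ (f≤g ∘ suc))

∑-mono-< : ∀ {n} {f g : Fin n → ℕ} i → (∀ j → f j ≤ g j) → f i < g i → ∑ f < ∑ g
∑-mono-< zero f≤g f<g = +-mono-<-≤ f<g (∑-mono-≤ (f≤g ∘ suc))
∑-mono-< (suc i) f≤g f<g = +-mono-≤-< (f≤g zero) (∑-mono-< i (f≤g ∘ suc) f<g)

∑-const : ∀ n x → ∑ {n} (λ _ → x) ≡ n * x
∑-const zero x = refl
∑-const (suc n) x = cong (x +_) (∑-const n x)

∑-+ : ∀ m {n} (f : Fin (m + n) → ℕ) → ∑ f ≡ ∑ (f ∘ (_↑ˡ n)) + ∑ (f ∘ (m ↑ʳ_))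
∑-+ zero f = refl
∑-+ (suc m) f = trans (cong (f zero +_) (∑-+ m (f ∘ suc))) (sym (+-assoc (f zero) _ _))

∑-* : ∀ m {n} (f : Fin (m * n) → ℕ) → ∑ f ≡ ∑ {m} (λ i → ∑ {n} (λ j → f (combine i j)))
∑-* zero f = refl
∑-* (suc m) {n} f = trans (∑-+ n f) (cong (∑ {n} (f ∘ combine {suc m} zero) +_) (∑-* m (f ∘ (n ↑ʳ_))))

∑-except : ∀ {n} (c : Fin n) x → x + ∑ (λ i → if does (i ≟ᶠ c) then 0 else x) ≡ n * x
∑-except {suc n} zero x = cong (x +_) (∑-const n x)
∑-except {suc n} (suc c) x = cong (x +_) (∑-except c x)

sum-map-filter : ∀ {A : Set} {P : A → Set} (P? : Decidable P) (f : A → ℕ) →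
                 (∀ x → (P x → f x ≡ 0)) → ∀ xs → sumᴸ (map f (filter (¬? ∘ P?) xs)) ≡ sumᴸ (map f xs)
sum-map-filter P? f f0 [] = refl
sum-map-filter P? f f0 (x ∷ xs) with P? x
... | yes p = trans (sum-map-filter P? f f0 xs) (cong (_+ sumᴸ (map f xs)) (sym (f0 x p)))
... | no ¬p = cong (f x +_) (sum-map-filter P? f f0 xs)

sum-tabulate : ∀ {n} (f : Fin n → ℕ) → sumᴸ (tabulate f) ≡ ∑ f
sum-tabulate {zero} f = refl
sum-tabulate {suc n} f = cong (f zero +_) (sum-tabulate (f ∘ suc))

sum-except-self : ∀ {n} (c : Fin n) (f : Fin n → ℕ) → f c ≡ 0 →
                  sumᴸ (map f (filter (λ v → ¬? (v ≟ᶠ c)) (allFin n))) ≡ ∑ f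
sum-except-self {n} c f fc = begin
  sumᴸ (map f (filter (λ v → ¬? (v ≟ᶠ c)) (allFin n))) ≡⟨ sum-map-filter (_≟ᶠ c) f (λ { _ refl → fc }) (allFin n) ⟩
  sumᴸ (map f (allFin n))                               ≡⟨ cong sumᴸ (map-tabulate id f) ⟩
  sumᴸ (tabulate f)                                     ≡⟨ sum-tabulate f ⟩
  ∑ f                                                   ∎
  where open ≡-Reasoning

module _ {n} (G : Graph n) where
  open Graph G

  infixr 5 _++ᵂ_

  _++ᵂ_ : ∀ {k l u v x} → Walk k u v → Walk l v x → Walk (k + l) u x
  [] ++ᵂ q = q
  (e ∷ p) ++ᵂ q = e ∷ (p ++ᵂ q)

  Adjacent-sym : ∀ {u v} → Adjacent u v → Adjacent v u
  Adjacent-sym (inj₁ e) = inj₂ e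
  Adjacent-sym (inj₂ e) = inj₁ e

  reverseᵂ : ∀ {k u v} → Walk k u v → ∃[ l ] Walk l v u
  reverseᵂ [] = 0 , []
  reverseᵂ (e ∷ p) with reverseᵂ p
  ... | l , q = l + 1 , q ++ᵂ (Adjacent-sym e ∷ [])

  -- A dual certificate for distances: such a function with value 0 at `c` stays below the distance
  -- from `c`, and equals it once walks of that length exist. As `Adjacent` is symmetric, the one
  -- inequality covers both directions.
  Lipschitz : (Fin n → ℕ) → Set
  Lipschitz f = ∀ {u v} → Adjacent u v → f v ≤ suc (f u)

  Lipschitz-walk : ∀ {f} → Lipschitz f → ∀ {k u v} → Walk k u v → f v ≤ k + f u
  Lipschitz-walk lip [] = ≤-refl
  Lipschitz-walk {f} lip {suc k} {u} (e ∷ p) =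
    ≤-trans (Lipschitz-walk lip p) (≤-trans (+-monoʳ-≤ k (lip e)) (≤-reflexive (+-suc k (f u))))

  distance-≥ : ∀ {f c v k} → Lipschitz f → f c ≡ 0 → Walk k c v → f v ≤ k
  distance-≥ {f} {k = k} lip fc p =
    ≤-trans (Lipschitz-walk lip p) (≤-reflexive (trans (cong (k +_) fc) (+-identityʳ k)))

  distanceSum-≥ : ∀ {f c x} → Lipschitz f → f c ≡ 0 → IsDistanceSum c x → ∑ f ≤ x
  distanceSum-≥ {f} {c} lip fc (d , dist , x≡) =
    ≤-trans (∑-mono-≤ (λ v → distance-≥ lip fc (proj₁ (dist v))))
            -- The distance from `c` to itself is 0 because of the empty walk.
            (≤-reflexive (sym (trans x≡ (sum-except-self c d (n≤0⇒n≡0 (proj₂ (dist c) 0 []))))))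

  distanceSum : ∀ {f c} → Lipschitz f → f c ≡ 0 → (∀ v → Walk (f v) c v) → IsDistanceSum c (∑ f)
  distanceSum {f} {c} lip fc walk =
    f , (λ v → walk v , λ _ → distance-≥ lip fc) , sym (sum-except-self c f fc)

-- Edge lists composed of segments

module _ {k} (len : Fin k → ℕ) where

  segment : (s : Fin k) → List (Σ (Fin k) (Fin ∘ len))
  segment s = map (s ,_) (allFin (len s))

  enumerate : List (Σ (Fin k) (Fin ∘ len))
  enumerate = concatMap segment (allFin k)

  ∈-enumerate : ∀ e → e ∈ enumerate
  ∈-enumerate (s , x) = ∈-concatMap⁺ segment {xs = allFin k}
    (Any.map (λ { refl → ∈-map⁺ (s ,_) (∈-allFin x) }) (∈-allFin s))

  enumerate-unique : Unique enumerate
  enumerate-unique = Unique.concat⁺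
    (All.map⁺ (All.universal (λ s → Unique.map⁺ (λ { refl → refl }) (Unique.allFin⁺ (len s))) (allFin k)))
    (AllPairs.map⁺ (AllPairs.map disjoint (Unique.allFin⁺ k)))
    where
    disjoint : ∀ {s t} → s ≢ t → ∀ {e} → e ∈ segment s × e ∈ segment t → _
    disjoint {s} {t} s≢t (p , q) with ∈-map⁻ (s ,_) p | ∈-map⁻ (t ,_) q
    ... | _ , _ , refl | _ , _ , refl = contradiction refl s≢t

  length-segments : ∀ ss → length (concatMap segment ss) ≡ sumᴸ (map len ss)
  length-segments [] = refl
  length-segments (s ∷ ss) = trans (length-++ (segment s))
    (cong₂ _+_ (trans (length-map {B = Σ (Fin k) (Fin ∘ len)} (s ,_) (allFin (len s))) (length-tabulate {n = len s} id)) (length-segments ss))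

-- The graph of two lists of sets

Close : ℕ → ℕ → Set
Close x y = x ≤ suc y × y ≤ suc x

-- A missing element leads to different leaves in the two lists, so that two sets lacking it acquire
-- no common neighbour.
kind : Bool → ∀ {A B : Set} → A ⊎ B → Fin 3
kind true  _        = 0F
kind false (inj₁ _) = 1F
kind false (inj₂ _) = 2F

slack : ∀ {x y} k → x + k ≡ y → x ≤ y
slack {x} k eq = ≤-trans (m≤m+n x k) (≤-reflexive eq)

module Construction (n e s : ℕ) (A B : Vec (Subset (suc e)) n) where

  d : ℕ
  d = suc e

  -- Hub 0 and the leaves are at distance at least 3 from the pendants, a set of the first list at
  -- distance 2; `3 * d + n` pendants on each of two hubs outweigh what the former save elsewhere.
  -- The summand `s` is padding: with `s = n * d` there are at most twice as many edges as vertices.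
  M : ℕ
  M = 3 * d + n + s

  Row : Set
  Row = Fin n ⊎ Fin n

  Vertex : Set
  Vertex = Fin 3 ⊎ (Fin 3 × Fin d) ⊎ Row ⊎ (Fin 2 × Fin M)

  pattern hub k = inj₁ k
  pattern leaf k j = inj₂ (inj₁ (k , j))
  pattern row r = inj₂ (inj₂ (inj₁ r))
  pattern rowA i = row (inj₁ i)
  pattern rowB i = row (inj₂ i)
  pattern pend k l = inj₂ (inj₂ (inj₂ (k , l)))

  N : ℕ
  N = 3 + (3 * d + ((n + n) + 2 * M))

  -- Hubs, leaves, rows, pendants: in this order every edge goes from the smaller number to the
  -- larger, as `ordered` demands.
  numbering : Fin N ↔ Vertex
  numbering = (↔-id _ ⊎-↔ ((*↔× ⊎-↔ ((+↔⊎ ⊎-↔ *↔×) ↔-∘ +↔⊎)) ↔-∘ +↔⊎)) ↔-∘ +↔⊎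

  open Inverse numbering public using () renaming (to to decode; from to code)

  decode-code : ∀ v → decode (code v) ≡ v
  decode-code = Inverse.strictlyInverseˡ numbering

  code-decode : ∀ x → code (decode x) ≡ x
  code-decode = Inverse.strictlyInverseʳ numbering

  code-injective : ∀ {u v} → code u ≡ code v → u ≡ v
  code-injective {u} {v} eq = trans (sym (decode-code u)) (trans (cong decode eq) (decode-code v))

  rowNumber : Row → ℕ
  rowNumber = [ toℕ , (λ i → n + toℕ i) ]′

  number : Vertex → ℕ
  number (hub k)    = toℕ k
  number (leaf k j) = 3 + (d * toℕ k + toℕ j)
  number (row r)    = 3 + (3 * d + rowNumber r)
  number (pend k l) = 3 + (3 * d + ((n + n) + (M * toℕ k + toℕ l)))

  toℕ-code : ∀ v → toℕ (code v) ≡ number v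
  toℕ-code (hub k) = toℕ-↑ˡ k _
  toℕ-code (leaf k j) = cong (3 +_) (trans (toℕ-↑ˡ (combine k j) _) (toℕ-combine k j))
  toℕ-code (row r) = cong (3 +_) (trans (toℕ-↑ʳ (3 * d) _) (cong (3 * d +_) (toℕ-row r)))
    where
    toℕ-row : ∀ r → toℕ (join n n r ↑ˡ 2 * M) ≡ rowNumber r
    toℕ-row (inj₁ i) = trans (toℕ-↑ˡ (i ↑ˡ n) _) (toℕ-↑ˡ i n)
    toℕ-row (inj₂ i) = trans (toℕ-↑ˡ (n ↑ʳ i) _) (toℕ-↑ʳ n i)
  toℕ-code (pend k l) = cong (3 +_) (trans (toℕ-↑ʳ (3 * d) _)
    (cong (3 * d +_) (trans (toℕ-↑ʳ (n + n) (combine k l)) (cong (n + n +_) (toℕ-combine k l)))))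

  bit : Row → Fin d → Bool
  bit (inj₁ i) j = lookup (lookup A i) j
  bit (inj₂ i) j = lookup (lookup B i) j

  slot : Row → Fin d → Fin 3
  slot r j = kind (bit r j) r

  infix 4 _—_

  data _—_ : Vertex → Vertex → Set where
    leaf-row : ∀ r j → leaf (slot r j) j — row r
    hub-leaf : ∀ k j → hub 0F — leaf k j
    hub-row  : ∀ k i → hub k — rowA i
    hub-pend : ∀ k l → hub (suc k) — pend k l

  -- Segment 0 has one edge per input bit, in input order. The other six are stars around a hub
  -- whose outer ends have consecutive numbers, so a single loop can write each of them.
  len : Fin 7 → ℕ
  len 0F = (n + n) * d
  len 1F = 3 * d
  len 2F = n
  len 3F = n
  len 4F = n
  len 5F = M
  len 6F = M

  bitEdge : Row × Fin d → Vertex × Vertex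
  bitEdge (r , j) = leaf (slot r j) j , row r

  rowColumn : Fin ((n + n) * d) → Row × Fin d
  rowColumn x = map₁ (splitAt n) (remQuot d x)

  rowColumn-combine : ∀ r j → rowColumn (combine (join n n r) j) ≡ (r , j)
  rowColumn-combine r j = trans (cong (map₁ (splitAt n)) (remQuot-combine (join n n r) j))
                                (cong (_, j) (splitAt-join n n r))

  combine-rowColumn : ∀ x → combine (join n n (proj₁ (rowColumn x))) (proj₂ (rowColumn x)) ≡ x
  combine-rowColumn x = trans
    (cong (λ i → combine i (proj₂ (remQuot {n + n} d x))) (join-splitAt n n (proj₁ (remQuot {n + n} d x))))
    (combine-remQuot {n + n} d x)

  ends : Σ (Fin 7) (Fin ∘ len) → Vertex × Vertex
  ends (0F , x) = bitEdge (rowColumn x)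
  ends (1F , x) = hub 0F , inj₂ (inj₁ (remQuot d x))
  ends (2F , i) = hub 0F , rowA i
  ends (3F , i) = hub 1F , rowA i
  ends (4F , i) = hub 2F , rowA i
  ends (5F , l) = hub 1F , pend 0F l
  ends (6F , l) = hub 2F , pend 1F l

  -- A partial left inverse makes the injectivity of `ends` a matter of seven cases instead of
  -- forty-nine pairs of segments.
  ends⁻¹ : Vertex × Vertex → Maybe (Σ (Fin 7) (Fin ∘ len))
  ends⁻¹ (leaf _ j , row r)    = just (0F , combine (join n n r) j)
  ends⁻¹ (hub _ , leaf k j)    = just (1F , combine k j)
  ends⁻¹ (hub 0F , rowA i)     = just (2F , i)
  ends⁻¹ (hub 1F , rowA i)     = just (3F , i)
  ends⁻¹ (hub 2F , rowA i)     = just (4F , i)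
  ends⁻¹ (hub _ , pend 0F l)   = just (5F , l)
  ends⁻¹ (hub _ , pend 1F l)   = just (6F , l)
  ends⁻¹ _                     = nothing

  ends⁻¹-ends : ∀ e → ends⁻¹ (ends e) ≡ just e
  ends⁻¹-ends (0F , x) = cong (λ y → just (0F , y)) (combine-rowColumn x)
  ends⁻¹-ends (1F , x) = cong (λ y → just (1F , y)) (combine-remQuot {3} d x)
  ends⁻¹-ends (2F , i) = refl
  ends⁻¹-ends (3F , i) = refl
  ends⁻¹-ends (4F , i) = refl
  ends⁻¹-ends (5F , l) = refl
  ends⁻¹-ends (6F , l) = refl

  ends-injective : ∀ {x y} → ends x ≡ ends y → x ≡ y
  ends-injective {x} {y} eq =
    just-injective (trans (sym (ends⁻¹-ends x)) (trans (cong ends⁻¹ eq) (ends⁻¹-ends y)))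

  ends-sound : ∀ x → proj₁ (ends x) — proj₂ (ends x)
  ends-sound (0F , x) = leaf-row _ _
  ends-sound (1F , x) = hub-leaf _ _
  ends-sound (2F , i) = hub-row 0F i
  ends-sound (3F , i) = hub-row 1F i
  ends-sound (4F , i) = hub-row 2F i
  ends-sound (5F , l) = hub-pend 0F l
  ends-sound (6F , l) = hub-pend 1F l

  ends-complete : ∀ {u v} → u — v → ∃[ x ] ends x ≡ (u , v)
  ends-complete (leaf-row r j) = (0F , combine (join n n r) j) , cong bitEdge (rowColumn-combine r j)
  ends-complete (hub-leaf k j) = (1F , combine k j) , cong (λ p → hub 0F , inj₂ (inj₁ p)) (remQuot-combine k j)
  ends-complete (hub-row 0F i) = (2F , i) , refl
  ends-complete (hub-row 1F i) = (3F , i) , refl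
  ends-complete (hub-row 2F i) = (4F , i) , refl
  ends-complete (hub-pend 0F l) = (5F , l) , refl
  ends-complete (hub-pend 1F l) = (6F , l) , refl

  number-< : ∀ {u v} → u — v → number u < number v
  number-< (leaf-row r j) = +-monoʳ-< 3 (<-≤-trans
    (subst (_< 3 * d) (toℕ-combine (slot r j) j) (toℕ<n (combine (slot r j) j))) (m≤m+n (3 * d) _))
  number-< (hub-leaf k j) = s≤s z≤n
  number-< (hub-row k i) = <-≤-trans (toℕ<n k) (m≤m+n 3 _)
  number-< (hub-pend k l) = <-≤-trans (toℕ<n (suc k)) (m≤m+n 3 _)

  edge : Σ (Fin 7) (Fin ∘ len) → Fin N × Fin N
  edge x = code (proj₁ (ends x)) , code (proj₂ (ends x))

  edge-injective : ∀ {x y} → edge x ≡ edge y → x ≡ y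
  edge-injective eq = ends-injective
    (cong₂ _,_ (code-injective (cong proj₁ eq)) (code-injective (cong proj₂ eq)))

  graph : Graph N
  graph = record
    { edges = map edge (enumerate len)
    ; ordered = All.map⁺ (All.universal
        (λ x → subst₂ _<_ (sym (toℕ-code (proj₁ (ends x)))) (sym (toℕ-code (proj₂ (ends x)))) (number-< (ends-sound x))) (enumerate len))
    ; unique = Unique.map⁺ edge-injective (enumerate-unique len)
    }

  open Graph graph using (edges; Adjacent; Walk; []; _∷_; Connected; IsDistanceSum; IsMedianValue)

  edge-count : ℕ
  edge-count = (n + n) * d + 3 * d + n + n + n + M + M

  length-edges : length edges ≡ edge-count
  length-edges = trans (length-map edge (enumerate len)) (trans (length-segments len (allFin 7))
                   (lemma ((n + n) * d) (3 * d) n M))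
    where
    lemma : ∀ a b c m → a + (b + (c + (c + (c + (m + (m + 0)))))) ≡ a + b + c + c + c + m + m
    lemma = solve-∀

  adjacent : ∀ {u v} → u — v → Adjacent (code u) (code v)
  adjacent u—v with ends-complete u—v
  ... | x , refl = inj₁ (∈-map⁺ edge (∈-enumerate len x))

  adjacent-elim : ∀ {P : Fin N → Fin N → Set} → (∀ {u v} → u — v → P (code u) (code v) × P (code v) (code u)) →
                  ∀ {x y} → Adjacent x y → P x y
  adjacent-elim p (inj₁ e) with ∈-map⁻ edge e
  ... | x , _ , refl = proj₁ (p (ends-sound x))
  adjacent-elim p (inj₂ e) with ∈-map⁻ edge e
  ... | x , _ , refl = proj₂ (p (ends-sound x))

  -- Lower bounds for distance sums

  Slow : (Vertex → ℕ) → Set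
  Slow f = ∀ {u v} → u — v → Close (f u) (f v)

  Slow-Lipschitz : ∀ {f} → Slow f → Lipschitz graph (f ∘ decode)
  Slow-Lipschitz {f} slow = adjacent-elim {λ x y → f (decode y) ≤ suc (f (decode x))} λ {u} {v} u—v →
    subst₂ (λ x y → f y ≤ suc (f x)) (sym (decode-code u)) (sym (decode-code v)) (proj₂ (slow u—v)) ,
    subst₂ (λ x y → f y ≤ suc (f x)) (sym (decode-code v)) (sym (decode-code u)) (proj₁ (slow u—v))

  total : (Vertex → ℕ) → ℕ
  total f = ∑ (λ k → f (hub k)) + (∑ {3} (λ k → ∑ (λ j → f (leaf k j)))
          + ((∑ (λ i → f (rowA i)) + ∑ (λ i → f (rowB i))) + ∑ {2} (λ k → ∑ (λ l → f (pend k l)))))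

  ∑-code : ∀ (h : Fin N → ℕ) → ∑ h ≡ total (h ∘ code)
  ∑-code h = trans (∑-+ 3 h) (cong (∑ (λ k → h (code (hub k))) +_) (trans (∑-+ (3 * d) (h ∘ (3 ↑ʳ_)))
    (cong₂ _+_ (∑-* 3 {d} (λ x → h (3 ↑ʳ (x ↑ˡ ((n + n) + 2 * M)))))
      (trans (∑-+ (n + n) (λ x → h (3 ↑ʳ (3 * d ↑ʳ x))))
        (cong₂ _+_ (∑-+ n (λ x → h (3 ↑ʳ (3 * d ↑ʳ (x ↑ˡ 2 * M)))))
                   (∑-* 2 {M} (λ x → h (3 ↑ʳ (3 * d ↑ʳ ((n + n) ↑ʳ x))))))))))

  ∑-decode : ∀ f → ∑ (f ∘ decode) ≡ total f
  ∑-decode f = trans (∑-code (f ∘ decode)) (total-cong (λ v → cong f (decode-code v)))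
    where
    total-cong : ∀ {f g} → f ≗ g → total f ≡ total g
    total-cong eq = cong₂ _+_ (∑-cong (λ k → eq (hub k))) (cong₂ _+_
      (∑-cong {3} (λ k → ∑-cong (λ j → eq (leaf k j)))) (cong₂ _+_
      (cong₂ _+_ (∑-cong (λ i → eq (rowA i))) (∑-cong (λ i → eq (rowB i))))
      (∑-cong {2} (λ k → ∑-cong (λ l → eq (pend k l))))))

  -- The quotient of the graph by these vertex classes has the edges listed in
  -- Compatible; the values used below are its distances from one class.
  potential : (h₀ h₁ h₂ l a b p₁ p₂ : ℕ) → Vertex → ℕ
  potential h₀ h₁ h₂ l a b p₁ p₂ (hub 0F)    = h₀
  potential h₀ h₁ h₂ l a b p₁ p₂ (hub 1F)    = h₁
  potential h₀ h₁ h₂ l a b p₁ p₂ (hub 2F)    = h₂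
  potential h₀ h₁ h₂ l a b p₁ p₂ (leaf _ _)  = l
  potential h₀ h₁ h₂ l a b p₁ p₂ (rowA _)    = a
  potential h₀ h₁ h₂ l a b p₁ p₂ (rowB _)    = b
  potential h₀ h₁ h₂ l a b p₁ p₂ (pend 0F _) = p₁
  potential h₀ h₁ h₂ l a b p₁ p₂ (pend 1F _) = p₂

  Compatible : (h₀ h₁ h₂ l a b p₁ p₂ : ℕ) → Set
  Compatible h₀ h₁ h₂ l a b p₁ p₂ =
    Close l a × Close l b × Close h₀ l × Close h₀ a × Close h₁ a × Close h₂ a × Close h₁ p₁ × Close h₂ p₂

  close? : ∀ x y → Dec (Close x y)
  close? x y = (x ≤? suc y) ×-dec (y ≤? suc x)

  compatible? : ∀ h₀ h₁ h₂ l a b p₁ p₂ → Dec (Compatible h₀ h₁ h₂ l a b p₁ p₂)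
  compatible? h₀ h₁ h₂ l a b p₁ p₂ =
    close? l a ×-dec close? l b ×-dec close? h₀ l ×-dec close? h₀ a ×-dec close? h₁ a ×-dec close? h₂ a
      ×-dec close? h₁ p₁ ×-dec close? h₂ p₂

  potential-slow : ∀ {h₀ h₁ h₂ l a b p₁ p₂} → Compatible h₀ h₁ h₂ l a b p₁ p₂ →
                   Slow (potential h₀ h₁ h₂ l a b p₁ p₂)
  potential-slow (la , lb , _) (leaf-row (inj₁ _) _) = la
  potential-slow (la , lb , _) (leaf-row (inj₂ _) _) = lb
  potential-slow (_ , _ , hl , _) (hub-leaf _ _) = hl
  potential-slow (_ , _ , _ , ha , _) (hub-row 0F _) = ha
  potential-slow (_ , _ , _ , _ , ha , _) (hub-row 1F _) = ha
  potential-slow (_ , _ , _ , _ , _ , ha , _) (hub-row 2F _) = ha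
  potential-slow (_ , _ , _ , _ , _ , _ , hp , _) (hub-pend 0F _) = hp
  potential-slow (_ , _ , _ , _ , _ , _ , _ , hp) (hub-pend 1F _) = hp

  total-potential : ∀ h₀ h₁ h₂ l a b p₁ p₂ → total (potential h₀ h₁ h₂ l a b p₁ p₂)
    ≡ (h₀ + h₁ + h₂) + (3 * (d * l) + (n * a + n * b + (M * p₁ + M * p₂)))
  total-potential h₀ h₁ h₂ l a b p₁ p₂ = cong₂ _+_ (lemma h₀ h₁ h₂) (cong₂ _+_
    (trans (∑-cong {3} (λ _ → ∑-const d l)) (∑-const 3 (d * l)))
    (cong₂ _+_ (cong₂ _+_ (∑-const n a) (∑-const n b))
      (cong₂ _+_ (∑-const M p₁) (trans (+-identityʳ _) (∑-const M p₂)))))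
    where
    lemma : ∀ x y z → x + (y + (z + 0)) ≡ x + y + z
    lemma = solve-∀

  distanceSum-≥-total : ∀ {f c x} → Slow f → f (decode c) ≡ 0 → IsDistanceSum c x → total f ≤ x
  distanceSum-≥-total {f} {x = x} slow fc sum-c =
    subst (_≤ x) (∑-decode f) (distanceSum-≥ graph (Slow-Lipschitz {f} slow) fc sum-c)

  -- One more than the distance sum of a set in the first list that meets
  -- every set in the second.
  threshold : ℕ
  threshold = 2 + (5 * d + (4 * n + 4 * M))

  -- Distances from the sets of the first list

  Meets : Fin n → Fin n → Set
  Meets i i′ = Nonempty (lookup A i ∩ lookup B i′)

  abstract
    meets? : ∀ i i′ → Dec (Meets i i′)
    meets? i i′ = nonempty? (lookup A i ∩ lookup B i′)

  Meets⁺ : ∀ {i i′} j → bit (inj₁ i) j ≡ true → bit (inj₂ i′) j ≡ true → Meets i i′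
  Meets⁺ {i} {i′} j a b = j , x∈p∩q⁺ (lookup⇒[]= j (lookup A i) a , lookup⇒[]= j (lookup B i′) b)

  Meets⁻ : ∀ {i i′} → Meets i i′ → ∃[ j ] bit (inj₁ i) j ≡ true × bit (inj₂ i′) j ≡ true
  Meets⁻ {i} {i′} (j , j∈) with x∈p∩q⁻ (lookup A i) (lookup B i′) j∈
  ... | a , b = j , []=⇒lookup a , []=⇒lookup b

  -- The distance from `rowA i`: `near-slow` makes it a lower bound, and `near-walk` attains it.
  near : Fin n → Vertex → ℕ
  near i (hub _)     = 1
  near i (leaf k j)  = if does (k ≟ᶠ slot (inj₁ i) j) then 1 else 2
  near i (rowA i′)   = if does (i′ ≟ᶠ i) then 0 else 2
  near i (rowB i′)   = if does (meets? i i′) then 2 else 3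
  near i (pend _ _)  = 2

  near-self : ∀ i → near i (rowA i) ≡ 0
  near-self i rewrite dec-true (i ≟ᶠ i) refl = refl

  -- Missing elements have kind 2 in the second list and kind 1 in the first, so equal slots are
  -- both of kind 0. In `near-slow` this excludes an edge from a leaf at distance 1 to a set at
  -- distance 3.
  slots-meet : ∀ {i i′} j → slot (inj₂ i′) j ≡ slot (inj₁ i) j → Meets i i′
  slots-meet {i} {i′} j eq with bit (inj₂ i′) j in b | bit (inj₁ i) j in a
  ... | true | true = Meets⁺ j a b
  slots-meet j () | true | false
  slots-meet j () | false | true
  slots-meet j () | false | false

  near-slow : ∀ i → Slow (near i)
  near-slow i (leaf-row (inj₁ i′) j) with slot (inj₁ i′) j ≟ᶠ slot (inj₁ i) j | i′ ≟ᶠ i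
  ... | yes _ | yes _ = s≤s z≤n , z≤n
  ... | yes _ | no _ = s≤s z≤n , s≤s (s≤s z≤n)
  ... | no ≢ | yes refl = contradiction refl ≢
  ... | no _ | no _ = s≤s (s≤s z≤n) , s≤s (s≤s z≤n)
  near-slow i (leaf-row (inj₂ i′) j) with slot (inj₂ i′) j ≟ᶠ slot (inj₁ i) j | meets? i i′
  ... | yes _ | yes _ = s≤s z≤n , s≤s (s≤s z≤n)
  ... | yes eq | no ¬meet = contradiction (slots-meet j eq) ¬meet
  ... | no _ | yes _ = s≤s (s≤s z≤n) , s≤s (s≤s z≤n)
  ... | no _ | no _ = s≤s (s≤s z≤n) , s≤s (s≤s (s≤s z≤n))
  near-slow i (hub-leaf k j) with k ≟ᶠ slot (inj₁ i) j
  ... | yes _ = s≤s z≤n , s≤s z≤n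
  ... | no _ = s≤s z≤n , s≤s (s≤s z≤n)
  near-slow i (hub-row k i′) with i′ ≟ᶠ i
  ... | yes _ = s≤s z≤n , z≤n
  ... | no _ = s≤s z≤n , s≤s (s≤s z≤n)
  near-slow i (hub-pend k l) = s≤s z≤n , s≤s (s≤s z≤n)

  adjacent˘ : ∀ {u v} → u — v → Adjacent (code v) (code u)
  adjacent˘ e = Adjacent-sym graph (adjacent e)

  near-walk : ∀ i v → Walk (near i v) (code (rowA i)) (code v)
  near-walk i (hub k) = adjacent˘ (hub-row k i) ∷ []
  near-walk i (leaf k j) with k ≟ᶠ slot (inj₁ i) j
  ... | yes refl = adjacent˘ (leaf-row (inj₁ i) j) ∷ []
  ... | no _ = adjacent˘ (hub-row 0F i) ∷ adjacent (hub-leaf k j) ∷ []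
  near-walk i (rowA i′) with i′ ≟ᶠ i
  ... | yes refl = []
  ... | no _ = adjacent˘ (hub-row 0F i) ∷ adjacent (hub-row 0F i′) ∷ []
  near-walk i (rowB i′) with meets? i i′
  ... | yes meet = let j , a , b = Meets⁻ meet in
    subst (λ k → Adjacent (code (rowA i)) (code (leaf k j))) (cong (λ x → kind x (inj₁ i)) a) (adjacent˘ (leaf-row (inj₁ i) j))
    ∷ subst (λ k → Adjacent (code (leaf k j)) (code (rowB i′))) (cong (λ x → kind x (inj₂ i′)) b) (adjacent (leaf-row (inj₂ i′) j))
    ∷ []
  -- Any column serves for the detour through hub 0; column 0 exists because `d` is a successor.
  ... | no _ = adjacent˘ (hub-row 0F i) ∷ adjacent (hub-leaf (slot (inj₂ i′) 0F) 0F) ∷ adjacent (leaf-row (inj₂ i′) 0F) ∷ []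
  near-walk i (pend k l) = adjacent˘ (hub-row (suc k) i) ∷ adjacent (hub-pend k l) ∷ []

  near-distanceSum : ∀ i → IsDistanceSum (code (rowA i)) (total (near i))
  near-distanceSum i = subst (IsDistanceSum (code (rowA i))) (∑-decode (near i))
    (distanceSum graph {near i ∘ decode} (Slow-Lipschitz {near i} (near-slow i))
      (trans (cong (near i) (decode-code (rowA i))) (near-self i))
      (λ v → subst (Walk _ _) (code-decode v) (near-walk i (decode v))))

  connected : Fin n → Connected
  connected i u v with reverseᵂ graph (near-walk i (decode u))
  ... | k , p = _ , subst₂ (Walk _) (code-decode u) (code-decode v)
                      (_++ᵂ_ graph p (near-walk i (decode v)))

  -- Each column has one leaf at distance 1 and two at distance 2, whether or not the element is
  -- present. This is why absent elements get an edge too.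
  near-leaves : ∀ i → ∑ {3} (λ k → ∑ (λ j → near i (leaf k j))) ≡ d * 5
  near-leaves i = trans (∑-comm +-0-commutativeMonoid (λ k j → near i (leaf k j)))
                        (trans (∑-cong column) (∑-const d 5))
    where
    column : ∀ j → ∑ {3} (λ k → near i (leaf k j)) ≡ 5
    column j with bit (inj₁ i) j
    ... | true = refl
    ... | false = refl

  -- The `n * 2` on the left stands for a second list at distance 2 throughout. Adding it instead of
  -- subtracting keeps the identity within the natural numbers, and any excess of the sum on the
  -- right over `n * 2` passes to the distance sum.
  total-near : ∀ i → 1 + total (near i) + n * 2 ≡ threshold + ∑ (λ i′ → near i (rowB i′))
  total-near i = lemma (∑-except i 2)
    where
    a = ∑ (λ i′ → near i (rowA i′))
    b = ∑ (λ i′ → near i (rowB i′))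
    rearrange : ∀ a d n M b → 4 + (d * 5 + ((a + b) + 2 * (M * 2))) + n * 2 ≡ (2 + a) + (2 + (5 * d + (2 * n + 4 * M))) + b
    rearrange = solve-∀
    regroup : ∀ d n M b → n * 2 + (2 + (5 * d + (2 * n + 4 * M))) + b ≡ 2 + (5 * d + (4 * n + 4 * M)) + b
    regroup = solve-∀
    lemma : 2 + a ≡ n * 2 → 1 + total (near i) + n * 2 ≡ threshold + b
    lemma eq = trans
      (cong (λ t → 1 + t + n * 2) (cong (3 +_) (cong₂ _+_ (near-leaves i) (cong ((a + b) +_)
        (trans (∑-cong {2} (λ _ → ∑-const M 2)) (∑-const 2 (M * 2)))))))
      (trans (rearrange a d n M b)
      (trans (cong (λ t → t + (2 + (5 * d + (2 * n + 4 * M))) + b) eq) (regroup d n M b)))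

  near-rowB-≥ : ∀ i i′ → 2 ≤ near i (rowB i′)
  near-rowB-≥ i i′ with meets? i i′
  ... | yes _ = s≤s (s≤s z≤n)
  ... | no _ = s≤s (s≤s z≤n)

  Hits : Fin n → Set
  Hits i = ∀ i′ → Meets i i′

  total-near-hits : ∀ i → Hits i → 1 + total (near i) ≡ threshold
  total-near-hits i hits = +-cancelʳ-≡ (n * 2) _ _ (trans (total-near i) (cong (threshold +_)
    (trans (∑-cong two) (∑-const n 2))))
    where
    two : ∀ i′ → near i (rowB i′) ≡ 2
    two i′ rewrite dec-true (meets? i i′) (hits i′) = refl

  -- One set at distance 3 instead of 2 already lifts the sum from just below the threshold to the
  -- threshold.
  total-near-misses : ∀ i i′ → ¬ Meets i i′ → threshold ≤ total (near i)
  total-near-misses i i′ ¬meet = s≤s⁻¹ (+-cancelʳ-≤ (n * 2) _ _ (begin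
    1 + threshold + n * 2 ≡⟨ sym (trans (+-suc threshold (n * 2)) refl) ⟩
    threshold + suc (n * 2) ≡⟨ cong (λ x → threshold + suc x) (sym (∑-const n 2)) ⟩
    threshold + suc (∑ {n} (λ _ → 2)) ≤⟨ +-monoʳ-≤ threshold (∑-mono-< i′ (near-rowB-≥ i) three) ⟩
    threshold + ∑ (λ i′ → near i (rowB i′)) ≡⟨ sym (total-near i) ⟩
    1 + total (near i) + n * 2 ∎))
    where
    open ≤-Reasoning
    three : 2 < near i (rowB i′)
    three rewrite dec-false (meets? i i′) ¬meet = ≤-refl

  -- The median lies in the first list if it is below the threshold

  potential-bound : ∀ {c x} h₀ h₁ h₂ l a b p₁ p₂ {compat : True (compatible? h₀ h₁ h₂ l a b p₁ p₂)} →
    potential h₀ h₁ h₂ l a b p₁ p₂ (decode c) ≡ 0 →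
    threshold ≤ (h₀ + h₁ + h₂) + (3 * (d * l) + (n * a + n * b + (M * p₁ + M * p₂))) →
    IsDistanceSum c x → threshold ≤ x
  potential-bound h₀ h₁ h₂ l a b p₁ p₂ {compat} zero-at-c bound sum-c = ≤-trans bound
    (≤-trans (≤-reflexive (sym (total-potential h₀ h₁ h₂ l a b p₁ p₂)))
      (distanceSum-≥-total (potential-slow (toWitness compat)) zero-at-c sum-c))

  -- Hub 0 and the leaves have all pendants at 3, and the surplus `2 * M` pays for what they save.
  -- Hubs 1 and 2 tie on the pendants with `M + 3 * M` and lose because all leaves are at 2. A
  -- pendant is credited with distance 0 to all pendants of its hub and still fails. The number
  -- given to `slack` is the margin that remains.
  other-distanceSum-≥ : ∀ {c x} v → decode c ≡ v → (∀ i → v ≢ rowA i) → IsDistanceSum c x → threshold ≤ x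
  other-distanceSum-≥ (hub 0F) eq _ =
    potential-bound 0 2 2 1 1 2 3 3 (cong (potential 0 2 2 1 1 2 3 3) eq)
      (slack (2 + 4 * d + n + 2 * s) (arithmetic n d s))
    where
    arithmetic : ∀ n d s → let M = 3 * d + n + s in
      2 + (5 * d + (4 * n + 4 * M)) + (2 + 4 * d + n + 2 * s) ≡ 4 + (3 * (d * 1) + (n * 1 + n * 2 + (M * 3 + M * 3)))
    arithmetic = solve-∀
  other-distanceSum-≥ (hub 1F) eq _ =
    potential-bound 2 0 2 2 1 3 1 3 (cong (potential 2 0 2 2 1 3 1 3) eq) (slack (2 + d) (arithmetic n d s))
    where
    arithmetic : ∀ n d s → let M = 3 * d + n + s in
      2 + (5 * d + (4 * n + 4 * M)) + (2 + d) ≡ 4 + (3 * (d * 2) + (n * 1 + n * 3 + (M * 1 + M * 3)))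
    arithmetic = solve-∀
  other-distanceSum-≥ (hub 2F) eq _ =
    potential-bound 2 2 0 2 1 3 3 1 (cong (potential 2 2 0 2 1 3 3 1) eq) (slack (2 + d) (arithmetic n d s))
    where
    arithmetic : ∀ n d s → let M = 3 * d + n + s in
      2 + (5 * d + (4 * n + 4 * M)) + (2 + d) ≡ 4 + (3 * (d * 2) + (n * 1 + n * 3 + (M * 3 + M * 1)))
    arithmetic = solve-∀
  other-distanceSum-≥ (leaf _ _) eq _ =
    potential-bound 1 2 2 0 1 1 3 3 (cong (potential 1 2 2 0 1 1 3 3) eq)
      (slack (3 + d + 2 * s) (arithmetic n d s))
    where
    arithmetic : ∀ n d s → let M = 3 * d + n + s in
      2 + (5 * d + (4 * n + 4 * M)) + (3 + d + 2 * s) ≡ 5 + (3 * (d * 0) + (n * 1 + n * 1 + (M * 3 + M * 3)))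
    arithmetic = solve-∀
  other-distanceSum-≥ (rowA i) _ other = contradiction refl (other i)
  other-distanceSum-≥ (rowB _) eq _ =
    potential-bound 2 3 3 1 2 0 4 4 (cong (potential 2 3 3 1 2 0 4 4) eq)
      (slack (6 + 10 * d + 2 * n + 4 * s) (arithmetic n d s))
    where
    arithmetic : ∀ n d s → let M = 3 * d + n + s in
      2 + (5 * d + (4 * n + 4 * M)) + (6 + 10 * d + 2 * n + 4 * s) ≡ 8 + (3 * (d * 1) + (n * 2 + n * 0 + (M * 4 + M * 4)))
    arithmetic = solve-∀
  other-distanceSum-≥ (pend 0F _) eq _ =
    potential-bound 3 1 3 3 2 4 0 4 (cong (potential 3 1 3 3 2 4 0 4) eq) (slack (5 + 4 * d + 2 * n) (arithmetic n d s))
    where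
    arithmetic : ∀ n d s → let M = 3 * d + n + s in
      2 + (5 * d + (4 * n + 4 * M)) + (5 + 4 * d + 2 * n) ≡ 7 + (3 * (d * 3) + (n * 2 + n * 4 + (M * 0 + M * 4)))
    arithmetic = solve-∀
  other-distanceSum-≥ (pend 1F _) eq _ =
    potential-bound 3 3 1 3 2 4 4 0 (cong (potential 3 3 1 3 2 4 4 0) eq) (slack (5 + 4 * d + 2 * n) (arithmetic n d s))
    where
    arithmetic : ∀ n d s → let M = 3 * d + n + s in
      2 + (5 * d + (4 * n + 4 * M)) + (5 + 4 * d + 2 * n) ≡ 7 + (3 * (d * 3) + (n * 2 + n * 4 + (M * 4 + M * 0)))
    arithmetic = solve-∀

  small-distanceSum⇒hits : ∀ {c x} → IsDistanceSum c x → x < threshold → ∃ Hits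
  small-distanceSum⇒hits {c} {x} sum-c x< with decode c in eq
  ... | rowA i = i , λ i′ → decidable-stable (meets? i i′) λ ¬meet → <⇒≱ x<
    (≤-trans (total-near-misses i i′ ¬meet)
      (distanceSum-≥-total (near-slow i) (trans (cong (near i) eq) (near-self i)) sum-c))
  ... | hub k = contradiction (other-distanceSum-≥ (hub k) eq (λ _ ()) sum-c) (<⇒≱ x<)
  ... | leaf k j = contradiction (other-distanceSum-≥ (leaf k j) eq (λ _ ()) sum-c) (<⇒≱ x<)
  ... | rowB i = contradiction (other-distanceSum-≥ (rowB i) eq (λ _ ()) sum-c) (<⇒≱ x<)
  ... | pend k l = contradiction (other-distanceSum-≥ (pend k l) eq (λ _ ()) sum-c) (<⇒≱ x<)

  median<⇒hits : ∀ {x} → IsMedianValue x → x < threshold → ∃ Hits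
  median<⇒hits ((c , sum-c) , _) = small-distanceSum⇒hits sum-c

  hits⇒median< : ∀ {x} → IsMedianValue x → ∃ Hits → x < threshold
  hits⇒median< {x} (_ , least) (i , hits) = ≤-trans (s≤s (least _ _ (near-distanceSum i)))
                                               (≤-reflexive (total-near-hits i hits))

-- Memory contents

contents-≥length : ∀ xs {i} → length xs ≤ i → contents xs i ≡ 0
contents-≥length [] _ = refl
contents-≥length (x ∷ xs) (s≤s le) = contents-≥length xs le

contents-++ˡ : ∀ xs ys {i} → i < length xs → contents (xs ++ ys) i ≡ contents xs i
contents-++ˡ (x ∷ xs) ys {zero} _ = refl
contents-++ˡ (x ∷ xs) ys {suc i} (s≤s lt) = contents-++ˡ xs ys lt

contents-++ʳ : ∀ xs ys i → contents (xs ++ ys) (length xs + i) ≡ contents ys i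
contents-++ʳ [] ys i = refl
contents-++ʳ (x ∷ xs) ys i = contents-++ʳ xs ys i

contents-snoc : ∀ xs v → contents xs [ length xs ↦ v ] ≗ contents (xs ++ v ∷ [])
contents-snoc [] v zero = refl
contents-snoc [] v (suc i) = refl
contents-snoc (x ∷ xs) v zero = refl
contents-snoc (x ∷ xs) v (suc i) = contents-snoc xs v i

length-snoc : ∀ (xs : List ℕ) v → length (xs ++ v ∷ []) ≡ suc (length xs)
length-snoc xs v = trans (length-++ xs) (+-comm (length xs) 1)

bitValue : Bool → ℕ
bitValue b = if b then 1 else 0

bitValue≤1 : ∀ b → bitValue b ≤ 1
bitValue≤1 true = ≤-refl
bitValue≤1 false = z≤n

bits : ∀ {m d} → Vec (Subset d) m → List ℕ
bits Ss = concatMap (λ S → map (λ b → if b then 1 else 0) (toList S)) (toList Ss)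

length-bits-row : ∀ {d} (S : Subset d) → length (map bitValue (toList S)) ≡ d
length-bits-row S = trans (length-map bitValue (toList S)) (length-toList S)

length-bits : ∀ {m d} (Ss : Vec (Subset d) m) → length (bits Ss) ≡ m * d
length-bits [] = refl
length-bits (S ∷ Ss) = trans (length-++ (map bitValue (toList S))) (cong₂ _+_ (length-bits-row S) (length-bits Ss))

contents-row : ∀ {d} (S : Subset d) j → contents (map bitValue (toList S)) (toℕ j) ≡ bitValue (lookup S j)
contents-row (b ∷ S) zero = refl
contents-row (b ∷ S) (suc j) = contents-row S j

contents-bits : ∀ {m d} (Ss : Vec (Subset d) m) i j →
                contents (bits Ss) (toℕ (combine i j)) ≡ bitValue (lookup (lookup Ss i) j)
contents-bits {suc m} {d} (S ∷ Ss) zero j = begin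
  contents (bits (S ∷ Ss)) (toℕ (j ↑ˡ (m * d))) ≡⟨ cong (contents (bits (S ∷ Ss))) (toℕ-↑ˡ j (m * d)) ⟩
  contents (bits (S ∷ Ss)) (toℕ j)               ≡⟨ contents-++ˡ (map bitValue (toList S)) (bits Ss) (subst (toℕ j <_) (sym (length-bits-row S)) (toℕ<n j)) ⟩
  contents (map bitValue (toList S)) (toℕ j)     ≡⟨ contents-row S j ⟩
  bitValue (lookup S j)                           ∎
  where open ≡-Reasoning
contents-bits {suc m} {d} (S ∷ Ss) (suc i) j = begin
  contents (bits (S ∷ Ss)) (toℕ (d ↑ʳ combine i j)) ≡⟨ cong (contents (bits (S ∷ Ss))) (trans (toℕ-↑ʳ d (combine i j)) (cong (_+ toℕ (combine i j)) (sym (length-bits-row S)))) ⟩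
  contents (bits (S ∷ Ss)) (length (map bitValue (toList S)) + toℕ (combine i j)) ≡⟨ contents-++ʳ (map bitValue (toList S)) (bits Ss) (toℕ (combine i j)) ⟩
  contents (bits Ss) (toℕ (combine i j)) ≡⟨ contents-bits Ss i j ⟩
  bitValue (lookup (lookup Ss i) j) ∎
  where open ≡-Reasoning

bits-++ : ∀ {m n d} (Ss : Vec (Subset d) m) (Ts : Vec (Subset d) n) → bits (Ss Vec.++ Ts) ≡ bits Ss ++ bits Ts
bits-++ Ss Ts = trans (cong (concatMap _) (toList-++ Ss Ts)) (concatMap-++ _ (toList Ss) (toList Ts))

-- Edge lists in memory

endpoints : ∀ {N} → Fin N × Fin N → List ℕ
endpoints (u , v) = toℕ u ∷ toℕ v ∷ []

-- The zeros past the end matter: the memory handed to the median program has to agree with the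
-- encoding in every cell.
contents-endpoints : ∀ {k N} (g : Fin k → Fin N × Fin N) (m : Mem) →
  (∀ x → m (toℕ x * 2) ≡ toℕ (proj₁ (g x)) × m (suc (toℕ x * 2)) ≡ toℕ (proj₂ (g x))) →
  (∀ i → k * 2 ≤ i → m i ≡ 0) → m ≗ contents (concatMap endpoints (tabulate g))
contents-endpoints {zero} g m at beyond i = beyond i z≤n
contents-endpoints {suc k} g m at beyond zero = proj₁ (at zero)
contents-endpoints {suc k} g m at beyond (suc zero) = proj₂ (at zero)
contents-endpoints {suc k} g m at beyond (suc (suc i)) =
  contents-endpoints (g ∘ suc) (λ i → m (2 + i)) (at ∘ suc) (λ i le → beyond (suc (suc i)) (s≤s (s≤s le))) i

star : (h v c : ℕ) → List ℕ
star h v zero = []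
star h v (suc c) = h ∷ v ∷ star h (suc v) c

length-star : ∀ h v c → length (star h v c) ≡ c * 2
length-star h v zero = refl
length-star h v (suc c) = cong (2 +_) (length-star h (suc v) c)

star-tabulate : ∀ {c N} (g : Fin c → Fin N × Fin N) h v → (∀ x → toℕ (proj₁ (g x)) ≡ h) →
                (∀ x → toℕ (proj₂ (g x)) ≡ v + toℕ x) → concatMap endpoints (tabulate g) ≡ star h v c
star-tabulate {zero} g h v eq₁ eq₂ = refl
star-tabulate {suc c} g h v eq₁ eq₂ = cong₂ _∷_ (eq₁ zero) (cong₂ _∷_ (trans (eq₂ zero) (+-identityʳ v))
  (star-tabulate (g ∘ suc) h (suc v) (eq₁ ∘ suc) (λ x → trans (eq₂ (suc x)) (+-suc v (toℕ x)))))

[d*q+r]/d≡q : ∀ d q {r} .{{_ : NonZero d}} → r < d → (d * q + r) / d ≡ q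
[d*q+r]/d≡q d q {r} r<d = begin
  (d * q + r) / d     ≡⟨ cong (_/ d) (cong (_+ r) (*-comm d q)) ⟩
  (q * d + r) / d     ≡⟨ +-distrib-/-∣ˡ r (n∣m*n q) ⟩
  q * d / d + r / d   ≡⟨ cong₂ _+_ (m*n/n≡m q d) (m<n⇒m/n≡0 r<d) ⟩
  q + 0               ≡⟨ +-identityʳ q ⟩
  q                   ∎
  where
  open ≡-Reasoning

[d*q+r]%d≡r : ∀ d q {r} .{{_ : NonZero d}} → r < d → (d * q + r) % d ≡ r
[d*q+r]%d≡r d q {r} r<d = begin
  (d * q + r) % d ≡⟨ cong (_% d) (trans (+-comm (d * q) r) (cong (r +_) (*-comm d q))) ⟩
  (r + q * d) % d ≡⟨ [m+kn]%n≡m%n r q d ⟩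
  r % d           ≡⟨ m<n⇒m%n≡m r<d ⟩
  r               ∎
  where open ≡-Reasoning

abstract
  -- One quantity above every number that the construction of the graph handles. Both `N` and the
  -- number of edges contain `9 * d`, and both get doubled, the former for the threshold and the
  -- latter for addresses; hence 18.
  reductionBound : (n d : ℕ) → ℕ
  reductionBound n d = 18 * (suc n * suc d)

  reductionBound≡ : ∀ n d → reductionBound n d ≡ 18 * (suc n * suc d)
  reductionBound≡ n d = refl

module Encoding (n e : ℕ) (A B : Vec (Subset (suc e)) n) where

  open Construction n e (n * suc e) A B public

  W : ℕ
  W = (n + n) * d

  input : List ℕ
  input = n ∷ d ∷ bits A ++ bits B

  length-input : length input ≡ 2 + W
  length-input = cong (2 +_) (trans (cong length (sym (bits-++ A B))) (length-bits (A Vec.++ B)))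

  toℕ-join : ∀ r → toℕ (join n n r) ≡ rowNumber r
  toℕ-join (inj₁ i) = toℕ-↑ˡ i n
  toℕ-join (inj₂ i) = toℕ-↑ʳ n i

  rowOf : Fin W → Row
  rowOf x = proj₁ (rowColumn x)

  columnOf : Fin W → Fin d
  columnOf x = proj₂ (rowColumn x)

  toℕ-rowColumn : ∀ x → toℕ x ≡ d * rowNumber (rowOf x) + toℕ (columnOf x)
  toℕ-rowColumn x = trans (cong toℕ (sym (combine-rowColumn x)))
    (trans (toℕ-combine (join n n (rowOf x)) (columnOf x)) (cong (λ y → d * y + toℕ (columnOf x)) (toℕ-join (rowOf x))))

  row-/ : ∀ x → toℕ x / d ≡ rowNumber (rowOf x)
  row-/ x = trans (cong (_/ d) (toℕ-rowColumn x)) ([d*q+r]/d≡q d (rowNumber (rowOf x)) (toℕ<n (columnOf x)))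

  column-% : ∀ x → toℕ x % d ≡ toℕ (columnOf x)
  column-% x = trans (cong (_% d) (toℕ-rowColumn x)) ([d*q+r]%d≡r d (rowNumber (rowOf x)) (toℕ<n (columnOf x)))

  input-bit : ∀ x → contents input (2 + toℕ x) ≡ bitValue (bit (rowOf x) (columnOf x))
  input-bit x = begin
    contents (bits A ++ bits B) (toℕ x)                                   ≡⟨ cong₂ contents (sym (bits-++ A B)) (cong toℕ (sym (combine-rowColumn x))) ⟩
    contents (bits (A Vec.++ B)) (toℕ (combine (join n n (rowOf x)) (columnOf x)))      ≡⟨ contents-bits (A Vec.++ B) (join n n (rowOf x)) (columnOf x) ⟩
    bitValue (lookup (lookup (A Vec.++ B) (join n n (rowOf x))) (columnOf x)) ≡⟨ cong bitValue (lookup-row (rowOf x) (columnOf x)) ⟩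
    bitValue (bit (rowOf x) (columnOf x)) ∎
    where
    open ≡-Reasoning
    lookup-row : ∀ r j → lookup (lookup (A Vec.++ B) (join n n r)) j ≡ bit r j
    lookup-row (inj₁ i) j = cong (λ S → lookup S j) (lookup-++ˡ A B i)
    lookup-row (inj₂ i) j = cong (λ S → lookup S j) (lookup-++ʳ A B i)

  -- A branch-free `kind`: a set bit makes the product vanish, and otherwise the comparison of the
  -- row number with `n` tells the lists apart and leaves 1 or 2.
  slot-value : ∀ r j → (1 ∸ bitValue (bit r j)) * (2 ∸ (if rowNumber r <ᵇ n then 1 else 0)) ≡ toℕ (slot r j)
  slot-value r j with bit r j
  ... | true = refl
  slot-value (inj₁ i) j | false with toℕ i <ᵇ n | <⇒<ᵇ (toℕ<n i)
  ... | true | _ = refl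
  slot-value (inj₂ i) j | false with n + toℕ i <ᵇ n | <ᵇ⇒< (n + toℕ i) n
  ... | false | _ = refl
  ... | true | f = ⊥-elim (m+n≮m n (toℕ i) (f _))

  low-end : ∀ x → 3 + (d * ((1 ∸ contents input (2 + toℕ x)) * (2 ∸ (if toℕ x / d <ᵇ n then 1 else 0))) + toℕ x % d)
                  ≡ toℕ (proj₁ (edge (zero , x)))
  low-end x = trans (cong (3 +_) (cong₂ (λ k c → d * k + c)
      (trans (cong₂ (λ b q → (1 ∸ b) * (2 ∸ (if q <ᵇ n then 1 else 0))) (input-bit x) (row-/ x))
             (slot-value (rowOf x) (columnOf x)))
      (column-% x)))
    (sym (toℕ-code (leaf (slot (rowOf x) (columnOf x)) (columnOf x))))

  high-end : ∀ x → 3 + (3 * d + toℕ x / d) ≡ toℕ (proj₂ (edge (zero , x)))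
  high-end x = trans (cong (λ q → 3 + (3 * d + q)) (row-/ x)) (sym (toℕ-code (row (rowOf x))))

  ends₀ : List ℕ
  ends₀ = concatMap endpoints (tabulate (λ x → edge (zero , x)))

  encoding : List ℕ
  encoding = N ∷ length (Graph.edges graph) ∷ concatMap endpoints (Graph.edges graph)

-- The program that writes the graph

pattern zeroʳ = 0F
pattern nʳ    = 1F
pattern dʳ    = 2F
pattern oneʳ  = 3F
pattern twoʳ  = 4F
pattern threeʳ = 5F
pattern baseʳ = 6F
pattern Mʳ    = 7F
pattern ctrʳ  = 8F
pattern ptrʳ  = 9F
pattern xʳ    = suc 9F
pattern yʳ    = suc (suc 9F)
pattern 2nʳ   = suc (suc (suc 9F))
pattern 3dʳ   = suc (suc (suc (suc 9F)))
pattern tʳ    = suc (suc (suc (suc (suc 9F))))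
pattern thresholdʳ = suc (suc (suc (suc (suc (suc 9F)))))

readHeader : List Instr
readHeader = load nʳ zeroʳ ∷ const oneʳ 1 ∷ load dʳ oneʳ ∷ []

setConstants : List Instr
setConstants = const twoʳ 2 ∷ const threeʳ 3 ∷ arith 3dʳ mul threeʳ dʳ ∷ arith baseʳ add threeʳ 3dʳ ∷ []

countBits : List Instr
countBits = arith 2nʳ add nʳ nʳ ∷ arith ctrʳ mul 2nʳ dʳ ∷ []

setM : List Instr
setM = arith tʳ mul nʳ dʳ ∷ arith Mʳ add 3dʳ nʳ ∷ arith Mʳ add Mʳ tʳ ∷ []

setUp : Program
setUp = block setConstants ⨾ block countBits ⨾ block setM

fetchBit : List Instr
fetchBit = arith ctrʳ sub ctrʳ oneʳ ∷ arith ptrʳ add twoʳ ctrʳ ∷ load ptrʳ ptrʳ ∷ []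

findRow : List Instr
findRow = arith xʳ div ctrʳ dʳ ∷ arith yʳ less xʳ nʳ ∷ arith yʳ sub twoʳ yʳ ∷ []

findKind : List Instr
findKind = arith ptrʳ sub oneʳ ptrʳ ∷ arith ptrʳ mul ptrʳ yʳ ∷ arith ptrʳ mul dʳ ptrʳ ∷ []

findEnds : List Instr
findEnds = arith yʳ mod ctrʳ dʳ ∷ arith ptrʳ add ptrʳ yʳ ∷ arith ptrʳ add threeʳ ptrʳ ∷ arith xʳ add baseʳ xʳ ∷ []

writeEnds : List Instr
writeEnds = arith yʳ mul ctrʳ twoʳ ∷ arith yʳ add twoʳ yʳ ∷ store yʳ ptrʳ
  ∷ arith yʳ add oneʳ yʳ ∷ store yʳ xʳ ∷ []

-- The bit at address 2 + j becomes the edge at addresses 2 + 2j and 3 + 2j;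
-- going down in j, no bit is overwritten before it is read.
expandBit : Program
expandBit = block fetchBit ⨾ block findRow ⨾ block findKind ⨾ block findEnds ⨾ block writeEnds

resetPointer : List Instr
resetPointer = arith ctrʳ mul 2nʳ dʳ ∷ arith ptrʳ mul ctrʳ twoʳ ∷ arith ptrʳ add twoʳ ptrʳ ∷ []

emitOne : List Instr
emitOne = store ptrʳ yʳ ∷ arith ptrʳ add oneʳ ptrʳ ∷ store ptrʳ xʳ ∷ arith ptrʳ add oneʳ ptrʳ
  ∷ arith xʳ add oneʳ xʳ ∷ arith ctrʳ sub ctrʳ oneʳ ∷ []

emitSetUp : ℕ → Reg → Reg → List Instr
emitSetUp h v c = const yʳ h ∷ arith xʳ add zeroʳ v ∷ arith ctrʳ add zeroʳ c ∷ []

emit : ℕ → Reg → Reg → Program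
emit h v c = block (emitSetUp h v c) ⨾ while≢0 toℕ {#regs} ctrʳ loop block emitOne

-- On entry `tʳ` is the number of the first pendant of hub 2, so adding `M` gives `N`. The pointer
-- stands just past the last edge; without the two header cells and halved, it counts the edges.
writeHeader : List Instr
writeHeader = arith tʳ add tʳ Mʳ ∷ store zeroʳ tʳ
  ∷ arith ptrʳ sub ptrʳ twoʳ ∷ arith ptrʳ div ptrʳ twoʳ ∷ store oneʳ ptrʳ ∷ []

-- By `threshold = 2 * N - d - 4`, the number of vertices left in `tʳ` is all that is needed.
setThreshold : List Instr
setThreshold = arith thresholdʳ add tʳ tʳ ∷ arith thresholdʳ sub thresholdʳ dʳ
  ∷ arith thresholdʳ sub thresholdʳ twoʳ ∷ arith thresholdʳ sub thresholdʳ twoʳ ∷ []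

finish : Program
finish = block writeHeader ⨾ block setThreshold

toPends : List Instr
toPends = arith tʳ add baseʳ 2nʳ ∷ []

advanceM : List Instr
advanceM = arith tʳ add tʳ Mʳ ∷ []

emitStars : Program
emitStars = emit 0 threeʳ 3dʳ
  ⨾ emit 0 baseʳ nʳ ⨾ emit 1 baseʳ nʳ ⨾ emit 2 baseʳ nʳ
  ⨾ block toPends
  ⨾ emit 1 tʳ Mʳ
  ⨾ block advanceM
  ⨾ emit 2 tʳ Mʳ
  ⨾ finish

buildGraph : Program
buildGraph = setUp
  ⨾ (while≢0 toℕ {#regs} ctrʳ loop expandBit)
  ⨾ block resetPointer
  ⨾ emitStars

-- Correctness and cost of `buildGraph`

module _ (n e : ℕ) (A B : Vec (Subset (suc e)) n) where

  open Encoding n e A B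

  segmentEnds : Fin 7 → List ℕ
  segmentEnds s = concatMap endpoints (tabulate (λ x → edge (s , x)))

  endpoints-segments : ∀ ss → concatMap endpoints (map edge (concatMap (segment len) ss)) ≡ concatMap segmentEnds ss
  endpoints-segments [] = refl
  endpoints-segments (s ∷ ss) = begin
    concatMap endpoints (map edge (segment len s ++ concatMap (segment len) ss))
      ≡⟨ cong (concatMap endpoints) (map-++ edge (segment len s) (concatMap (segment len) ss)) ⟩
    concatMap endpoints (map edge (segment len s) ++ map edge (concatMap (segment len) ss))
      ≡⟨ concatMap-++ endpoints (map edge (segment len s)) _ ⟩
    concatMap endpoints (map edge (segment len s)) ++ concatMap endpoints (map edge (concatMap (segment len) ss))
      ≡⟨ cong₂ _++_ (cong (concatMap endpoints) (trans (cong (map edge) (map-tabulate id (s ,_))) (map-tabulate (s ,_) edge)))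
                    (endpoints-segments ss) ⟩
    segmentEnds s ++ concatMap segmentEnds ss ∎
    where open ≡-Reasoning

  base : ℕ
  base = 3 + 3 * d

  pends : ℕ
  pends = base + (n + n)

  segment₁ : segmentEnds 1F ≡ star 0 3 (3 * d)
  segment₁ = star-tabulate (λ x → edge (1F , x)) 0 3 (λ x → toℕ-code (hub 0F))
    λ x → trans (toℕ-code (proj₂ (ends (1F , x)))) (cong (3 +_) (trans (sym (toℕ-combine (proj₁ (remQuot {3} d x)) (proj₂ (remQuot {3} d x)))) (cong toℕ (combine-remQuot {3} d x))))

  segment-row : ∀ k (g : Fin n → Fin N × Fin N) → (∀ i → g i ≡ (code (hub k) , code (rowA i))) →
                concatMap endpoints (tabulate g) ≡ star (toℕ k) base n
  segment-row k g eq = star-tabulate g (toℕ k) base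
    (λ i → trans (cong (toℕ ∘ proj₁) (eq i)) (toℕ-code (hub k)))
    (λ i → trans (cong (toℕ ∘ proj₂) (eq i)) (toℕ-code (rowA i)))

  segment-pend : ∀ k (g : Fin M → Fin N × Fin N) → (∀ l → g l ≡ (code (hub (suc k)) , code (pend k l))) →
                 concatMap endpoints (tabulate g) ≡ star (suc (toℕ k)) (pends + M * toℕ k) M
  segment-pend k g eq = star-tabulate g (suc (toℕ k)) (pends + M * toℕ k)
    (λ l → trans (cong (toℕ ∘ proj₁) (eq l)) (toℕ-code (hub (suc k))))
    (λ l → trans (cong (toℕ ∘ proj₂) (eq l)) (trans (toℕ-code (pend k l))
      (rearrange (3 * d) (n + n) (M * toℕ k) (toℕ l))))
    where
    rearrange : ∀ a b c l → 3 + (a + (b + (c + l))) ≡ 3 + a + b + c + l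
    rearrange = solve-∀

  allEnds : List ℕ
  allEnds = ends₀ ++ star 0 3 (3 * d) ++ star 0 base n ++ star 1 base n ++ star 2 base n
         ++ star 1 pends M ++ star 2 (pends + M) M

  edges-ends : concatMap endpoints (Graph.edges graph) ≡ allEnds
  edges-ends = trans (endpoints-segments (allFin 7))
    (cong (ends₀ ++_) (cong₂ _++_ segment₁ (cong₂ _++_ (segment-row 0F _ λ _ → refl)
      (cong₂ _++_ (segment-row 1F _ λ _ → refl) (cong₂ _++_ (segment-row 2F _ λ _ → refl)
      (cong₂ _++_ (trans (segment-pend 0F _ λ _ → refl) (cong (λ v → star 1 v M) (trans (cong (pends +_) (*-zeroʳ M)) (+-identityʳ pends))))
        (trans (++-identityʳ (segmentEnds 6F))
          (trans (segment-pend 1F _ λ _ → refl) (cong (λ v → star 2 (pends + v) M) (*-identityʳ M))))))))))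

  length-concatMap-endpoints : ∀ {k} (es : List (Fin k × Fin k)) → length (concatMap endpoints es) ≡ length es * 2
  length-concatMap-endpoints [] = refl
  length-concatMap-endpoints (_ ∷ es) = cong (2 +_) (length-concatMap-endpoints es)

  length-allEnds : length allEnds ≡ edge-count * 2
  length-allEnds = trans (cong length (sym edges-ends))
    (trans (length-concatMap-endpoints (Graph.edges graph)) (cong (_* 2) length-edges))

  length-ends₀ : length ends₀ ≡ W * 2
  length-ends₀ = trans (length-concatMap-endpoints (tabulate (λ x → edge (0F , x))))
                       (cong (_* 2) (length-tabulate (λ x → edge (0F , x))))

  bound : ℕ
  bound = reductionBound n d

  N≡ : pends + M + M ≡ N
  N≡ = rearrange (3 * d) (n + n) M
    where
    rearrange : ∀ a b m → 3 + a + b + m + m ≡ 3 + (a + (b + 2 * m))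
    rearrange = solve-∀

  N+N≤bound : N + N ≤ bound
  N+N≤bound = slack (12 + 10 * n + 14 * (n * d)) (trans (arithmetic n d) (sym (reductionBound≡ n d)))
    where
    arithmetic : ∀ n d → let M = 3 * d + n + n * d ; N = 3 + (3 * d + ((n + n) + 2 * M)) in
      N + N + (12 + 10 * n + 14 * (n * d)) ≡ 18 * (suc n * suc d)
    arithmetic = solve-∀

  2+edges≤bound : 2 + edge-count * 2 ≤ bound
  2+edges≤bound = slack (16 + 8 * n + 10 * (n * d)) (trans (arithmetic n d) (sym (reductionBound≡ n d)))
    where
    arithmetic : ∀ n d → let M = 3 * d + n + n * d in
      2 + ((n + n) * d + 3 * d + n + n + n + M + M) * 2 + (16 + 8 * n + 10 * (n * d)) ≡ 18 * (suc n * suc d)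
    arithmetic = solve-∀

  2+W*2≤bound : 2 + W * 2 ≤ bound
  2+W*2≤bound = ≤-trans (+-monoʳ-≤ 2 (*-monoˡ-≤ 2 W≤)) 2+edges≤bound
    where
    W≤ : W ≤ edge-count
    W≤ = slack (3 * d + n + n + n + M + M) (arithmetic W (3 * d) n M)
      where
      arithmetic : ∀ w a n m → w + (a + n + n + n + m + m) ≡ w + a + n + n + n + m + m
      arithmetic = solve-∀

  N≤bound : N ≤ bound
  N≤bound = ≤-trans (m≤m+n N N) N+N≤bound

  pends+M≤bound : pends + M ≤ bound
  pends+M≤bound = ≤-trans (m≤m+n (pends + M) M) (≤-trans (≤-reflexive N≡) N≤bound)

  pends≤bound : pends ≤ bound
  pends≤bound = ≤-trans (m≤m+n pends M) pends+M≤bound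

  base≤bound : base ≤ bound
  base≤bound = ≤-trans (m≤m+n base (n + n)) pends≤bound

  -- An emitted edge costs 8 steps: six instructions, the `skip` that ends the block, and the loop
  -- test. In `buildTime` a bit costs 24: eighteen instructions in five blocks, and the test.
  starTime : ℕ
  starTime = (4 + suc (3 * d * 8)) + ((4 + suc (n * 8)) + ((4 + suc (n * 8)) + ((4 + suc (n * 8))
    + (2 + ((4 + suc (M * 8)) + (2 + ((4 + suc (M * 8)) + 11)))))))

  buildTime : ℕ
  buildTime = 12 + (suc (W * 24) + (4 + starTime))

  buildTime≤ : buildTime ≤ 4 * bound
  buildTime≤ = slack (10 + 32 * n + 8 * (n * d)) (trans (arithmetic n d) (cong (4 *_) (sym (reductionBound≡ n d))))
    where
    arithmetic : ∀ n d → let M = 3 * d + n + n * d in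
      12 + (suc ((n + n) * d * 24) + (4 + ((4 + suc (3 * d * 8)) + ((4 + suc (n * 8)) + ((4 + suc (n * 8)) + ((4 + suc (n * 8))
        + (2 + ((4 + suc (M * 8)) + (2 + ((4 + suc (M * 8)) + 11)))))))))) + (10 + 32 * n + 8 * (n * d))
      ≡ 4 * (18 * (suc n * suc d))
    arithmetic = solve-∀

  -- Once the set-up is over only these six registers change.
  frame : (ctr ptr x y t threshold : ℕ) → Regs
  frame ctr ptr x y t q = 0 ∷ n ∷ d ∷ 1 ∷ 2 ∷ 3 ∷ base ∷ M ∷ ctr ∷ ptr ∷ x ∷ y ∷ n + n ∷ 3 * d ∷ t ∷ q ∷ []

  initialRegs : Regs
  initialRegs = 0 ∷ n ∷ d ∷ 1 ∷ 0 ∷ 0 ∷ 0 ∷ 0 ∷ 0 ∷ 0 ∷ 0 ∷ 0 ∷ 0 ∷ 0 ∷ 0 ∷ 0 ∷ []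

  Built : Regs → Mem → Set
  Built vs m = lookup vs thresholdʳ ≡ threshold × m ≗ contents encoding

  -- Runs on words wide enough for `bound`

  module _ {w : ℕ} (bound< : bound < 2 ^ w) where

    fits : ∀ {x} → x ≤ bound → x < 2 ^ w
    fits x≤ = ≤-<-trans x≤ bound<

    fits-small : ∀ {x} → x ≤ 3 → x < 2 ^ w
    fits-small x≤3 = fits (≤-trans x≤3 (≤-trans (m≤m+n 3 (3 * d)) base≤bound))

    -- With `j` bits left, memory holds the unread bits, a gap of unspecified cells, the finished
    -- edges, and zeros. The gap closes at `j = 0`. Nothing is said about the two header cells,
    -- which are rewritten last.
    HalfExpanded : ℕ → Regs → Mem → Set
    HalfExpanded j vs m = ∃[ ptr ] ∃[ x ] ∃[ y ] vs ≡ frame j ptr x y (n * d) 0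
      × (∀ i → i < j → m (2 + i) ≡ contents input (2 + i))
      × (∀ (x : Fin W) → j ≤ toℕ x → m (2 + toℕ x * 2) ≡ toℕ (proj₁ (edge (0F , x)))
                                     × m (3 + toℕ x * 2) ≡ toℕ (proj₂ (edge (0F , x))))
      × (∀ i → W * 2 ≤ i → m (2 + i) ≡ 0)
      × j ≤ W

    lowEnd : ℕ → ℕ → ℕ
    lowEnd b j = 3 + (d * ((1 ∸ b) * (2 ∸ (if j / d <ᵇ n then 1 else 0))) + j % d)

    lowEnd≡ : ∀ {b j} (x : Fin W) → toℕ x ≡ j → b ≡ contents input (2 + j) → lowEnd b j ≡ toℕ (proj₁ (edge (0F , x)))
    lowEnd≡ x refl refl = low-end x

    highEnd≡ : ∀ {j} (x : Fin W) → toℕ x ≡ j → base + j / d ≡ toℕ (proj₂ (edge (0F , x)))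
    highEnd≡ x refl = high-end x

    At : Regs → Mem → Regs → Mem → Set
    At vs m vs′ m′ = vs′ ≡ vs × m′ ≡ m

    run-fetchBit : ∀ {j ptr x y t m} → 2 + j ≤ bound → m (2 + j) ≤ 3 →
      Runs w (block fetchBit) 4 (At (frame j (m (2 + j)) x y t 0) m) (frame (suc j) ptr x y t 0) m
    run-fetchBit 2+j≤ bit≤ = run-block fetchBit
      (fits (≤-trans (m≤n+m _ 2) 2+j≤) , fits 2+j≤ , fits-small bit≤ , refl , refl)

    run-findRow : ∀ {j b x y t m} → j ≤ bound →
      Runs w (block findRow) 4 (At (frame j b (j / d) (2 ∸ (if j / d <ᵇ n then 1 else 0)) t 0) m) (frame j b x y t 0) m
    run-findRow {j} j≤ = run-block findRow
      ( fits (≤-trans (m/n≤m j d) j≤) , fits-small (≤-trans (bitValue≤1 (j / d <ᵇ n)) (s≤s z≤n))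
      , fits-small (≤-trans (m∸n≤m 2 (if j / d <ᵇ n then 1 else 0)) (s≤s (s≤s z≤n))) , refl , refl )

    run-findKind : ∀ {j b x y t m} → d * ((1 ∸ b) * y) ≤ bound →
      Runs w (block findKind) 4 (At (frame j (d * ((1 ∸ b) * y)) x y t 0) m) (frame j b x y t 0) m
    run-findKind {b = b} {y = y} d*k≤ = run-block findKind
      ( fits-small (≤-trans (m∸n≤m 1 b) (s≤s z≤n)) , fits (≤-trans (m≤m+n _ (e * ((1 ∸ b) * y))) d*k≤) , fits d*k≤
      , refl , refl )

    run-findEnds : ∀ {j k x y t m} → 3 + (k + j % d) ≤ bound → base + x ≤ bound →
      Runs w (block findEnds) 5 (At (frame j (3 + (k + j % d)) (base + x) (j % d) t 0) m) (frame j k x y t 0) m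
    run-findEnds {j} {k} low≤ high≤ = run-block findEnds
      ( fits (≤-trans (m≤n+m (j % d) k) k≤) , fits k≤ , fits low≤ , fits high≤ , refl , refl )
      where k≤ = ≤-trans (m≤n+m (k + j % d) 3) low≤

    run-writeEnds : ∀ {j lo hi y t m} → 3 + j * 2 ≤ bound →
      Runs w (block writeEnds) 6 (At (frame j lo hi (3 + j * 2) t 0) ((m [ 2 + j * 2 ↦ lo ]) [ 3 + j * 2 ↦ hi ]))
                                 (frame j lo hi y t 0) m
    run-writeEnds {j} ≤bound = run-block writeEnds
      ( fits (≤-trans (m≤n+m (j * 2) 3) ≤bound) , fits (≤-trans (n≤1+n _) ≤bound) , tt , fits ≤bound , tt , refl , refl )

    run-expandBit : ∀ j {vs m} → HalfExpanded (suc j) vs m → Runs w expandBit 23 (HalfExpanded j) vs m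
    run-expandBit j {m = m} (ptr , x , y , refl , unread , done , beyond , j<W) =
      run-seq (run-fetchBit 2+j≤ (≤-trans (≤-reflexive b≡) (≤-trans (bitValue≤1 (bit (rowOf v) (columnOf v))) (s≤s z≤n)))) λ { _ _ (refl , refl) →
      run-seq (run-findRow j≤) λ { _ _ (refl , refl) →
      run-seq (run-findKind d*k≤) λ { _ _ (refl , refl) →
      run-seq (run-findEnds low≤ high≤) λ { _ _ (refl , refl) →
      run-map (λ { (refl , refl) → _ , _ , _ , refl , unread′ , done′ , beyond′ , ≤-trans (n≤1+n j) j<W })
              (run-writeEnds 3+j*2≤) }}}}
      where
      v : Fin W
      v = fromℕ< j<W

      v≡ : toℕ v ≡ j
      v≡ = toℕ-fromℕ< j<W

      b : ℕ
      b = m (2 + j)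

      k : ℕ
      k = (1 ∸ b) * (2 ∸ (if j / d <ᵇ n then 1 else 0))

      b≡ : b ≡ bitValue (bit (rowOf v) (columnOf v))
      b≡ = trans (unread j ≤-refl) (trans (cong (λ i → contents input (2 + i)) (sym v≡)) (input-bit v))

      low≡ : lowEnd b j ≡ toℕ (proj₁ (edge (0F , v)))
      low≡ = lowEnd≡ v v≡ (unread j ≤-refl)

      high≡ : base + j / d ≡ toℕ (proj₂ (edge (0F , v)))
      high≡ = highEnd≡ v v≡

      low≤ : lowEnd b j ≤ bound
      low≤ = subst (_≤ bound) (sym low≡) (≤-trans (<⇒≤ (toℕ<n (proj₁ (edge (0F , v))))) N≤bound)

      high≤ : base + j / d ≤ bound
      high≤ = subst (_≤ bound) (sym high≡) (≤-trans (<⇒≤ (toℕ<n (proj₂ (edge (0F , v))))) N≤bound)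

      d*k≤ : d * k ≤ bound
      d*k≤ = ≤-trans (m≤m+n (d * k) (j % d)) (≤-trans (m≤n+m _ 3) low≤)

      1+j*2<W*2 : 2 + j * 2 ≤ W * 2
      1+j*2<W*2 = *-monoˡ-≤ 2 j<W

      3+j*2≤ : 3 + j * 2 ≤ bound
      3+j*2≤ = ≤-trans (s≤s (≤-trans 1+j*2<W*2 (n≤1+n _))) 2+W*2≤bound

      2+j≤ : 2 + j ≤ bound
      2+j≤ = ≤-trans (+-monoʳ-≤ 2 (m≤m*n j 2)) (≤-trans (n≤1+n _) 3+j*2≤)

      j≤ : j ≤ bound
      j≤ = ≤-trans (m≤n+m j 2) 2+j≤

      m′ : Mem
      m′ = (m [ 2 + j * 2 ↦ lowEnd b j ]) [ 3 + j * 2 ↦ base + j / d ]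

      elsewhere : ∀ {i} → 2 + j * 2 ≢ i → 3 + j * 2 ≢ i → m′ i ≡ m i
      elsewhere ≢₁ ≢₂ = trans ([↦]-miss (m [ 2 + j * 2 ↦ lowEnd b j ]) _ ≢₂) ([↦]-miss m _ ≢₁)

      -- Since `i < j ≤ j * 2`, both writes land above every unread bit.
      unread′ : ∀ i → i < j → m′ (2 + i) ≡ contents input (2 + i)
      unread′ i i<j = trans (elsewhere (>⇒≢ (+-monoʳ-< 2 i<)) (>⇒≢ (≤-trans (+-monoʳ-< 2 i<) (n≤1+n _))))
                            (unread i (m≤n⇒m≤1+n i<j))
        where
        i< : i < j * 2
        i< = <-≤-trans i<j (m≤m*n j 2)

      done′ : ∀ (x : Fin W) → j ≤ toℕ x → m′ (2 + toℕ x * 2) ≡ toℕ (proj₁ (edge (0F , x)))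
                                         × m′ (3 + toℕ x * 2) ≡ toℕ (proj₂ (edge (0F , x)))
      done′ x j≤x with j ≟ toℕ x
      ... | yes refl =
        trans ([↦]-miss (m [ 2 + j * 2 ↦ lowEnd b j ]) _ (>⇒≢ ≤-refl))
          (trans ([↦]-hit m (2 + j * 2) _) (lowEnd≡ x refl (unread j ≤-refl)))
        , trans ([↦]-hit (m [ 2 + j * 2 ↦ lowEnd b j ]) (3 + j * 2) _) (highEnd≡ x refl)
      ... | no j≢x =
        trans (elsewhere (<⇒≢ (≤-trans (n≤1+n _) after)) (<⇒≢ after)) (proj₁ (done x j<x))
        , trans (elsewhere (<⇒≢ (≤-trans (≤-trans (n≤1+n _) after) (n≤1+n _))) (<⇒≢ (≤-trans after (n≤1+n _)))) (proj₂ (done x j<x))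
        where
        j<x : j < toℕ x
        j<x = ≤∧≢⇒< j≤x j≢x

        after : 3 + j * 2 < 2 + toℕ x * 2
        after = +-monoʳ-≤ 2 (*-monoˡ-≤ 2 j<x)

      beyond′ : ∀ i → W * 2 ≤ i → m′ (2 + i) ≡ 0
      beyond′ i W≤i = trans (elsewhere (<⇒≢ (+-monoʳ-< 2 (<⇒≤ j<i))) (<⇒≢ (+-monoʳ-< 2 j<i))) (beyond i W≤i)
        where
        j<i : suc (j * 2) < i
        j<i = ≤-trans 1+j*2<W*2 W≤i

    -- Emitting the stars

    Emitted : ℕ → List ℕ → Regs → Mem → Set
    Emitted t ys vs m = ∃[ ctr ] ∃[ x ] ∃[ y ] vs ≡ frame ctr (length ys) x y t 0 × m ≗ contents ys

    -- What is written and the star still to come always concatenate to the fixed `target`. The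
    -- bound on `v + j` keeps each increment of the outer end within a word.
    Emitting : (h t : ℕ) (target : List ℕ) → ℕ → Regs → Mem → Set
    Emitting h t target j vs m = ∃[ zs ] ∃[ v ] vs ≡ frame j (length zs) v h t 0 × m ≗ contents zs
      × zs ++ star h v j ≡ target × v + j ≤ bound

    run-emitOne : ∀ {h t target} → length target ≤ bound → ∀ j {vs m} → Emitting h t target (suc j) vs m →
                  Runs w (block emitOne) 7 (Emitting h t target j) vs m
    run-emitOne {h} {target = target} target≤ j {m = m} (zs , v , refl , m≗ , zs-target , v+j≤) = run-block emitOne
      ( tt , fits (≤-trans (n≤1+n _) 2+zs≤) , tt , fits 2+zs≤
      , fits (≤-trans (m≤m+n (suc v) j) 1+v+j≤) , fits (≤-trans (m≤n+m j (suc v)) 1+v+j≤)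
      , zs′ , suc v , cong (λ p → frame j p (suc v) h _ 0) (sym length-zs′) , m′≗
      , trans (trans (++-assoc (zs ++ h ∷ []) (v ∷ []) _) (++-assoc zs (h ∷ []) _)) zs-target , 1+v+j≤ )
      where
      zs′ : List ℕ
      zs′ = (zs ++ h ∷ []) ++ v ∷ []

      length-zs′ : length zs′ ≡ 2 + length zs
      length-zs′ = trans (length-snoc (zs ++ h ∷ []) v) (cong suc (length-snoc zs h))

      1+v+j≤ : suc v + j ≤ bound
      1+v+j≤ = ≤-trans (≤-reflexive (sym (+-suc v j))) v+j≤

      2+zs≤ : 2 + length zs ≤ bound
      2+zs≤ = ≤-trans (≤-trans (≤-reflexive (+-comm 2 (length zs)))
        (≤-trans (+-monoʳ-≤ (length zs) (s≤s (s≤s z≤n)))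
          (≤-reflexive (sym (trans (cong length (sym zs-target)) (length-++ zs)))))) target≤

      m′≗ : (m [ length zs ↦ h ]) [ suc (length zs) ↦ v ] ≗ contents zs′
      m′≗ i = trans ([↦]-cong (suc (length zs)) v (λ i → trans ([↦]-cong (length zs) h m≗ i) (contents-snoc zs h i)) i)
        (trans (cong (λ p → (contents (zs ++ h ∷ []) [ p ↦ v ]) i) (sym (length-snoc zs h)))
               (contents-snoc (zs ++ h ∷ []) v i))

    -- The quantifiers express that `r` is not a scratch register: its value survives what
    -- `emitSetUp` writes before reading it.
    Holds : ℕ → Reg → ℕ → Set
    Holds t r x = ∀ ctr ptr v h → lookup (frame ctr ptr v h t 0) r ≡ x

    run-emitSetUp : ∀ h v c {V C t ctr ptr x y m} → h ≤ 3 → Holds t v V → Holds t c C → V + C ≤ bound →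
      Runs w (block (emitSetUp h v c)) 4 (At (frame C ptr V h t 0) m) (frame ctr ptr x y t 0) m
    run-emitSetUp h v c {V} {C} {t} {ctr} {ptr} {x} {y} {m} h≤ v≡ c≡ V+C≤ =
      run-map (λ { (refl , refl) → cong₂ (λ c v → frame c ptr v h t 0) C≡ V≡ , refl })
        (run-block {Q = At (frame C′ ptr V′ h t 0) m} (emitSetUp h v c)
          ( fits-small h≤
          , fits (subst (_≤ bound) (sym V≡) (≤-trans (m≤m+n V C) V+C≤))
          , fits (subst (_≤ bound) (sym C≡) (≤-trans (m≤n+m C V) V+C≤))
          , refl , refl ))
      where
      V′ C′ : ℕ
      V′ = lookup (frame ctr ptr x h t 0) v
      C′ = lookup (frame ctr ptr V′ h t 0) c

      V≡ : V′ ≡ V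
      V≡ = v≡ ctr ptr x h

      C≡ : C′ ≡ C
      C≡ = c≡ ctr ptr V′ h

    run-emit : ∀ h v c {V C t ys} → h ≤ 3 → Holds t v V → Holds t c C → V + C ≤ bound → length (ys ++ star h V C) ≤ bound →
      ∀ {vs m} → Emitted t ys vs m → Runs w (emit h v c) (4 + suc (C * 8)) (Emitted t (ys ++ star h V C)) vs m
    run-emit h v c {V} {C} {t} {ys} h≤ v≡ c≡ V+C≤ ys≤ {m = m} (ctr , x , y , refl , m≗) =
      run-seq (run-emitSetUp h v c h≤ v≡ c≡ V+C≤) λ { _ _ (refl , refl) →
        run-map done (run-while {r = ctrʳ} (Emitting h t (ys ++ star h V C)) (λ { j (_ , _ , refl , _) → refl })
          (run-emitOne ys≤) C (ys , V , refl , m≗ , refl , V+C≤)) }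
      where
      done : ∀ {vs m} → Emitting h t (ys ++ star h V C) 0 vs m → Emitted t (ys ++ star h V C) vs m
      done (zs , v , refl , m≗ , zs≡ , _) =
        0 , v , h , cong (λ zs → frame 0 (length zs) v h t 0) zs≡′
        , (λ i → trans (m≗ i) (cong (λ zs → contents zs i) zs≡′))
        where zs≡′ = trans (sym (++-identityʳ zs)) zs≡

    Emitted-≡ : ∀ {t ys zs vs m} → ys ≡ zs → Emitted t ys vs m → Emitted t zs vs m
    Emitted-≡ refl em = em

    expanded : ∀ {vs m} → HalfExpanded 0 vs m → Runs w (block resetPointer) 4
               (λ vs m → ∃[ a ] ∃[ b ] Emitted (n * d) (a ∷ b ∷ ends₀) vs m) vs m
    expanded {m = m} (_ , x , y , refl , _ , done , beyond , _) = run-block resetPointer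
      ( fits (≤-trans (m≤m*n W 2) W*2≤) , fits W*2≤ , fits 2+W*2≤bound
      -- The header cells have arbitrary content here and are carried along until `writeHeader`.
      , m 0 , m 1 , W , x , y , cong (λ l → frame W (2 + l) x y (n * d) 0) (sym length-ends₀) , m≗ )
      where
      m≗ : m ≗ contents (m 0 ∷ m 1 ∷ ends₀)
      m≗ zero = refl
      m≗ (suc zero) = refl
      m≗ (suc (suc i)) = contents-endpoints (λ x → edge (0F , x)) (λ i → m (2 + i)) (λ x → done x z≤n) beyond i

      W*2≤ : W * 2 ≤ bound
      W*2≤ = ≤-trans (n≤1+n _) (≤-trans (n≤1+n _) 2+W*2≤bound)

    run-writeHeader : ∀ {l E t t′ ctr x y m} → t + M ≡ t′ → l / 2 ≡ E → t′ ≤ bound → l ≤ bound →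
      Runs w (block writeHeader) 6 (At (frame ctr E x y t′ 0) ((m [ 0 ↦ t′ ]) [ 1 ↦ E ])) (frame ctr (2 + l) x y t 0) m
    run-writeHeader {l} refl refl t≤ l≤ = run-block writeHeader
      ( fits t≤ , tt , fits l≤ , fits (≤-trans (m/n≤m l 2) l≤) , tt , refl , refl )

    run-setThreshold : ∀ {t q ctr ptr x y m} → t + t ∸ d ∸ 2 ∸ 2 ≡ q → t + t ≤ bound →
      Runs w (block setThreshold) 5 (At (frame ctr ptr x y t q) m) (frame ctr ptr x y t 0) m
    run-setThreshold {t} refl t+t≤ = run-block setThreshold
      ( fits t+t≤ , fits ≤₁ , fits ≤₂ , fits (≤-trans (m∸n≤m (t + t ∸ d ∸ 2) 2) ≤₂) , refl , refl )
      where
      ≤₁ = ≤-trans (m∸n≤m (t + t) d) t+t≤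
      ≤₂ = ≤-trans (m∸n≤m (t + t ∸ d) 2) ≤₁

    run-finish : ∀ {a b vs m} → Emitted (pends + M) (a ∷ b ∷ allEnds) vs m → Runs w finish 11 Built vs m
    run-finish {a} {b} {m = m} (_ , _ , _ , refl , m≗) =
      run-seq (run-writeHeader {length allEnds} {length (Graph.edges graph)} {pends + M} {N} N≡ half N≤bound allEnds≤) λ { _ _ (refl , refl) →
        run-map (λ { (refl , refl) → refl , m′≗ }) (run-setThreshold {N} threshold≡ N+N≤bound) }
      where
      allEnds≤ : length allEnds ≤ bound
      allEnds≤ = ≤-trans (≤-reflexive length-allEnds) (≤-trans (m≤n+m _ 2) 2+edges≤bound)

      threshold≡ : N + N ∸ d ∸ 2 ∸ 2 ≡ threshold
      threshold≡ = trans (cong (λ x → x ∸ d ∸ 2 ∸ 2) (arithmetic n d M))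
        (trans (cong (λ x → x ∸ 2 ∸ 2) (m+n∸n≡m (threshold + 2 + 2) d))
        (trans (cong (_∸ 2) (m+n∸n≡m (threshold + 2) 2)) (m+n∸n≡m threshold 2)))
        where
        arithmetic : ∀ n d M → let N = 3 + (3 * d + ((n + n) + 2 * M)) in
          N + N ≡ 2 + (5 * d + (4 * n + 4 * M)) + 2 + 2 + d
        arithmetic = solve-∀

      half : length allEnds / 2 ≡ length (Graph.edges graph)
      half = trans (cong (_/ 2) length-allEnds) (trans (m*n/n≡m edge-count 2) (sym length-edges))

      m′≗ : (m [ 0 ↦ N ]) [ 1 ↦ length (Graph.edges graph) ] ≗ contents encoding
      m′≗ zero = refl
      m′≗ (suc zero) = refl
      m′≗ (suc (suc i)) = trans (m≗ (2 + i)) (cong (λ xs → contents xs i) (sym edges-ends))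

    constantRegs : Regs
    constantRegs = 0 ∷ n ∷ d ∷ 1 ∷ 2 ∷ 3 ∷ base ∷ 0 ∷ 0 ∷ 0 ∷ 0 ∷ 0 ∷ 0 ∷ 3 * d ∷ 0 ∷ 0 ∷ []

    run-setConstants : ∀ {m} → Runs w (block setConstants) 5 (At constantRegs m) initialRegs m
    run-setConstants = run-block setConstants
      ( fits-small (s≤s (s≤s z≤n)) , fits-small ≤-refl
      , fits (≤-trans (m≤n+m (3 * d) 3) base≤bound) , fits base≤bound , refl , refl )

    countedRegs : Regs
    countedRegs = 0 ∷ n ∷ d ∷ 1 ∷ 2 ∷ 3 ∷ base ∷ 0 ∷ W ∷ 0 ∷ 0 ∷ 0 ∷ n + n ∷ 3 * d ∷ 0 ∷ 0 ∷ []

    run-countBits : ∀ {m} → Runs w (block countBits) 3 (At countedRegs m) constantRegs m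
    run-countBits = run-block countBits
      ( fits (≤-trans (m≤n+m (n + n) base) pends≤bound)
      , fits (≤-trans (m≤m*n W 2) (≤-trans (m≤n+m (W * 2) 2) 2+W*2≤bound)) , refl , refl )

    run-setM : ∀ {m} → Runs w (block setM) 4 (At (frame W 0 0 0 (n * d) 0) m) countedRegs m
    run-setM = run-block setM
      ( fits (≤-trans (m≤n+m (n * d) (3 * d + n)) M≤bound)
      , fits (≤-trans (m≤m+n (3 * d + n) (n * d)) M≤bound) , fits M≤bound , refl , refl )
      where
      M≤bound : M ≤ bound
      M≤bound = ≤-trans (m≤n+m M pends) pends+M≤bound

    run-setUp : Runs w setUp 12 (HalfExpanded W) initialRegs (contents input)
    run-setUp =
      run-seq run-setConstants λ { _ _ (refl , refl) →
      run-seq run-countBits λ { _ _ (refl , refl) →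
      run-map (λ { (refl , refl) → 0 , 0 , 0 , refl , (λ _ _ → refl)
        , (λ x W≤x → contradiction (toℕ<n x) (≤⇒≯ W≤x))
        , (λ i W*2≤i → contents-≥length input (≤-trans (≤-reflexive length-input) (s≤s (s≤s (≤-trans (m≤m*n W 2) W*2≤i)))))
        , ≤-refl }) run-setM }}

    base+n≤bound : base + n ≤ bound
    base+n≤bound = ≤-trans (+-monoʳ-≤ base (m≤m+n n n)) pends≤bound

    run-toPends : ∀ {t′ ctr ptr x y t m} → base + (n + n) ≡ t′ → t′ ≤ bound →
      Runs w (block toPends) 2 (At (frame ctr ptr x y t′ 0) m) (frame ctr ptr x y t 0) m
    run-toPends refl t′≤ = run-block toPends (fits t′≤ , refl , refl)

    run-advanceM : ∀ {t′ ctr ptr x y t m} → t + M ≡ t′ → t′ ≤ bound →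
      Runs w (block advanceM) 2 (At (frame ctr ptr x y t′ 0) m) (frame ctr ptr x y t 0) m
    run-advanceM refl t′≤ = run-block advanceM (fits t′≤ , refl , refl)

    module Stars (a b : ℕ) where

      ys₀ ys₁ ys₂ ys₃ ys₄ ys₅ ys₆ : List ℕ
      ys₀ = a ∷ b ∷ ends₀
      ys₁ = ys₀ ++ star 0 3 (3 * d)
      ys₂ = ys₁ ++ star 0 base n
      ys₃ = ys₂ ++ star 1 base n
      ys₄ = ys₃ ++ star 2 base n
      ys₅ = ys₄ ++ star 1 pends M
      ys₆ = ys₅ ++ star 2 (pends + M) M

      flatten : ∀ (a b c d e f g : List ℕ) → (((((a ++ b) ++ c) ++ d) ++ e) ++ f) ++ g ≡ a ++ b ++ c ++ d ++ e ++ f ++ g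
      flatten a b c d e f g = trans (++-assoc ((((a ++ b) ++ c) ++ d) ++ e) f g)
        (trans (++-assoc (((a ++ b) ++ c) ++ d) e _) (trans (++-assoc ((a ++ b) ++ c) d _)
        (trans (++-assoc (a ++ b) c _) (++-assoc a b _))))

      prefix : ∀ (xs : List ℕ) {ys} → length (xs ++ ys) ≤ bound → length xs ≤ bound
      prefix xs le = ≤-trans (≤-trans (m≤m+n (length xs) _) (≤-reflexive (sym (length-++ xs)))) le

      ys₆≡ : ys₆ ≡ a ∷ b ∷ allEnds
      ys₆≡ = flatten ys₀ (star 0 3 (3 * d)) (star 0 base n) (star 1 base n) (star 2 base n) (star 1 pends M) (star 2 (pends + M) M)

      ys₆≤ : length ys₆ ≤ bound
      ys₆≤ = ≤-trans (≤-reflexive (trans (cong length ys₆≡) (cong (2 +_) length-allEnds))) 2+edges≤bound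

      ys₅≤ : length ys₅ ≤ bound
      ys₅≤ = prefix ys₅ ys₆≤

      ys₄≤ : length ys₄ ≤ bound
      ys₄≤ = prefix ys₄ ys₅≤

      ys₃≤ : length ys₃ ≤ bound
      ys₃≤ = prefix ys₃ ys₄≤

      ys₂≤ : length ys₂ ≤ bound
      ys₂≤ = prefix ys₂ ys₃≤

      ys₁≤ : length ys₁ ≤ bound
      ys₁≤ = prefix ys₁ ys₂≤

      run-leaves : ∀ {vs m} → Emitted (n * d) ys₀ vs m → Runs w (emit 0 threeʳ 3dʳ) (4 + suc (3 * d * 8)) (Emitted (n * d) ys₁) vs m
      run-leaves = run-emit 0 threeʳ 3dʳ {3} {3 * d} z≤n (λ _ _ _ _ → refl) (λ _ _ _ _ → refl) base≤bound ys₁≤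

      run-rows : ∀ k {ys vs m} → k ≤ 3 → length (ys ++ star k base n) ≤ bound → Emitted (n * d) ys vs m →
                 Runs w (emit k baseʳ nʳ) (4 + suc (n * 8)) (Emitted (n * d) (ys ++ star k base n)) vs m
      run-rows k {ys} k≤ ys≤ = run-emit k baseʳ nʳ {base} {n} {ys = ys} k≤ (λ _ _ _ _ → refl) (λ _ _ _ _ → refl) base+n≤bound ys≤

      run-pendants : ∀ k {v ys vs m} → k ≤ 3 → v + M ≤ bound → length (ys ++ star k v M) ≤ bound → Emitted v ys vs m →
                     Runs w (emit k tʳ Mʳ) (4 + suc (M * 8)) (Emitted v (ys ++ star k v M)) vs m
      run-pendants k {v} {ys} k≤ v≤ ys≤ = run-emit k tʳ Mʳ {v} {M} {ys = ys} k≤ (λ _ _ _ _ → refl) (λ _ _ _ _ → refl) v≤ ys≤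

      run-pends : ∀ {ys vs m} → Emitted (n * d) ys vs m → Runs w (block toPends) 2 (Emitted pends ys) vs m
      run-pends (ctr , x , y , refl , m≗) = run-map (λ { (refl , refl) → ctr , x , y , refl , m≗ }) (run-toPends refl pends≤bound)

      run-pends+M : ∀ {ys vs m} → Emitted pends ys vs m → Runs w (block advanceM) 2 (Emitted (pends + M) ys) vs m
      run-pends+M (ctr , x , y , refl , m≗) = run-map (λ { (refl , refl) → ctr , x , y , refl , m≗ }) (run-advanceM refl pends+M≤bound)

      run-stars : ∀ {vs m} → Emitted (n * d) ys₀ vs m → Runs w emitStars starTime Built vs m
      run-stars em₀ =
        run-seq (run-leaves em₀) λ _ _ em₁ →
        run-seq (run-rows 0 z≤n ys₂≤ em₁) λ _ _ em₂ →
        run-seq (run-rows 1 (s≤s z≤n) ys₃≤ em₂) λ _ _ em₃ →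
        run-seq (run-rows 2 (s≤s (s≤s z≤n)) ys₄≤ em₃) λ _ _ em₄ →
        run-seq (run-pends em₄) λ _ _ em₄′ →
        run-seq (run-pendants 1 (s≤s z≤n) pends+M≤bound ys₅≤ em₄′) λ _ _ em₅ →
        run-seq (run-pends+M em₅) λ _ _ em₅′ →
        run-seq (run-pendants 2 (s≤s (s≤s z≤n)) (≤-trans (≤-reflexive N≡) N≤bound) ys₆≤ em₅′) λ _ _ em₆ →
        run-finish (Emitted-≡ ys₆≡ em₆)

    run-buildGraph : Runs w buildGraph buildTime Built initialRegs (contents input)
    run-buildGraph = run-seq run-setUp λ _ _ half →
      run-seq (run-while {r = ctrʳ} HalfExpanded (λ { _ (_ , _ , _ , refl , _) → refl }) run-expandBit W half) λ _ _ full →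
      run-seq (expanded full) λ { _ _ (a , b , em₀) → Stars.run-stars a b em₀ }

-- Time and word size

n<2^n : ∀ n → n < 2 ^ n
n<2^n zero = s≤s z≤n
n<2^n (suc n) = ≤-trans (+-mono-≤ (m^n>0 2 n) (n<2^n n)) (≤-reflexive (cong (2 ^ n +_) (sym (+-identityʳ (2 ^ n)))))

n≤2⌈n/2⌉ : ∀ n → n ≤ 2 * ⌈ n /2⌉
n≤2⌈n/2⌉ n = ≤-trans (≤-reflexive (sym (⌊n/2⌋+⌈n/2⌉≡n n)))
  (≤-trans (+-monoˡ-≤ ⌈ n /2⌉ (⌊n/2⌋≤⌈n/2⌉ n)) (≤-reflexive (cong (⌈ n /2⌉ +_) (sym (+-identityʳ ⌈ n /2⌉)))))

n≤2^⌈log₂n⌉ : ∀ n → n ≤ 2 ^ ⌈log₂ n ⌉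
n≤2^⌈log₂n⌉ = <-rec _ step
  where
  step : ∀ n → (∀ {m} → m < n → m ≤ 2 ^ ⌈log₂ m ⌉) → n ≤ 2 ^ ⌈log₂ n ⌉
  step zero ih = z≤n
  step (suc zero) ih = s≤s z≤n
  step n@(suc (suc n₀)) ih = begin
    n                             ≤⟨ n≤2⌈n/2⌉ n ⟩
    2 * ⌈ n /2⌉                   ≤⟨ *-monoʳ-≤ 2 (ih (⌈n/2⌉<n n₀)) ⟩
    2 ^ suc ⌈log₂ ⌈ n /2⌉ ⌉       ≡⟨ cong (λ l → 2 ^ suc l) (⌈log₂⌈n/2⌉⌉≡⌈log₂n⌉∸1 n) ⟩
    2 ^ suc (⌈log₂ n ⌉ ∸ 1)       ≡⟨ cong (2 ^_) (m+[n∸m]≡n {1} (⌈log₂⌉-mono-≤ {2} {n} (s≤s (s≤s z≤n)))) ⟩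
    2 ^ ⌈log₂ n ⌉                 ∎
    where open ≤-Reasoning

-- If the logarithm is `suc l`, then `n ≤ 2 ^ l` is impossible, as monotonicity would make the
-- logarithm at most `l`.
2^⌈log₂n⌉≤2n : ∀ n → 1 ≤ n → 2 ^ ⌈log₂ n ⌉ ≤ 2 * n
2^⌈log₂n⌉≤2n n 1≤n with ⌈log₂ n ⌉ in eq
... | zero = ≤-trans 1≤n (m≤n*m n 2)
... | suc l = *-monoʳ-≤ 2 {2 ^ l} {n} (<⇒≤ (≰⇒> λ n≤ → <⇒≱ (n<1+n l)
  (≤-trans (≤-reflexive (sym eq)) (≤-trans (⌈log₂⌉-mono-≤ {n} {2 ^ l} n≤) (≤-reflexive (⌈log₂2^n⌉≡n l))))))

^-distribʳ-* : ∀ k x y → (x * y) ^ k ≡ x ^ k * y ^ k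
^-distribʳ-* zero x y = refl
^-distribʳ-* (suc k) x y = trans (cong (x * y *_) (^-distribʳ-* k x y)) (interchange x y (x ^ k) (y ^ k))
  where
  interchange : ∀ a b c d → a * b * (c * d) ≡ a * c * (b * d)
  interchange = solve-∀

-- With a = l / m, 1 + l ≤ m (1 + a) ≤ m 2 ^ a.
[1+l]^m≤m^m*2^l : ∀ m .{{_ : NonZero m}} l → (1 + l) ^ m ≤ m ^ m * 2 ^ l
[1+l]^m≤m^m*2^l m l = begin
  (1 + l) ^ m                ≤⟨ ^-monoˡ-≤ m 1+l≤ ⟩
  (m * 2 ^ (l / m)) ^ m      ≡⟨ ^-distribʳ-* m m (2 ^ (l / m)) ⟩
  m ^ m * (2 ^ (l / m)) ^ m  ≡⟨ cong (m ^ m *_) (^-*-assoc 2 (l / m) m) ⟩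
  m ^ m * 2 ^ (l / m * m)    ≤⟨ *-monoʳ-≤ (m ^ m) (^-monoʳ-≤ 2 (m/n*n≤m l m)) ⟩
  m ^ m * 2 ^ l              ∎
  where
  open ≤-Reasoning
  1+l≤ : 1 + l ≤ m * 2 ^ (l / m)
  1+l≤ = begin
    1 + l                     ≡⟨ cong suc (m≡m%n+[m/n]*n l m) ⟩
    suc (l % m) + l / m * m   ≤⟨ +-monoˡ-≤ (l / m * m) (m%n<n l m) ⟩
    suc (l / m) * m           ≤⟨ *-monoˡ-≤ m (n<2^n (l / m)) ⟩
    2 ^ (l / m) * m           ≡⟨ *-comm (2 ^ (l / m)) m ⟩
    m * 2 ^ (l / m)           ∎

[x+y]^k≤2^k[x^k+y^k] : ∀ k x y → (x + y) ^ k ≤ 2 ^ k * (x ^ k + y ^ k)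
[x+y]^k≤2^k[x^k+y^k] k x y with ≤-total x y
... | inj₁ x≤y = ≤-trans (^-monoˡ-≤ k (≤-trans (+-monoˡ-≤ y x≤y) (≤-reflexive (cong (y +_) (sym (+-identityʳ y))))))
  (≤-trans (≤-reflexive (^-distribʳ-* k 2 y)) (*-monoʳ-≤ (2 ^ k) (m≤n+m (y ^ k) (x ^ k))))
... | inj₂ y≤x = ≤-trans (^-monoˡ-≤ k (≤-trans (+-monoʳ-≤ x y≤x) (≤-reflexive (cong (x +_) (sym (+-identityʳ x))))))
  (≤-trans (≤-reflexive (^-distribʳ-* k 2 x)) (*-monoʳ-≤ (2 ^ k) (m≤m+n (x ^ k) (y ^ k))))

x≤x^[1+k] : ∀ x k → x ≤ x ^ suc k
x≤x^[1+k] zero k = z≤n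
x≤x^[1+k] x@(suc _) k = m≤m*n x (x ^ k) {{m^n≢0 x k}}

reductionBound-≤ : ∀ {n c} l → 1 ≤ n → 1 ≤ c → reductionBound n (c * l) ≤ 36 * c * (n * suc l)
reductionBound-≤ {n} {c} l 1≤n 1≤c = begin
  reductionBound n (c * l)       ≡⟨ reductionBound≡ n (c * l) ⟩
  18 * (suc n * suc (c * l))     ≤⟨ *-monoʳ-≤ 18 (*-mono-≤ (+-monoˡ-≤ n 1≤n) (+-monoˡ-≤ (c * l) 1≤c)) ⟩
  18 * ((n + n) * (c + c * l))   ≡⟨ regroup n c l ⟩
  36 * c * (n * suc l)           ∎
  where
  open ≤-Reasoning
  regroup : ∀ n c l → 18 * ((n + n) * (c + c * l)) ≡ 36 * c * (n * suc l)
  regroup = solve-∀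

-- Absorbing the logarithm into the exponent

module Exponents (q′ C c : ℕ) where

  -- Here `m` is `2 * q - 1`, so a time bound with ε = 1 / q reads `t ^ q ≤ C ^ q * b ^ m`. It is
  -- squared later, whence `m + m`. `E` gathers the constants of building and solving, `F` those of
  -- the logarithm.
  q m E F K : ℕ
  q = suc q′
  m = q′ + q
  E = 2 ^ q * (5 ^ q + C ^ q)
  F = 2 * (m + m) ^ (m + m)
  K = E * E * (36 * c) ^ (m + m) * F

  instance
    m-nonZero : NonZero m
    m-nonZero = >-nonZero (≤-trans (s≤s z≤n) (m≤n+m q q′))

    m+m-nonZero : NonZero (m + m)
    m+m-nonZero = >-nonZero (≤-trans (>-nonZero⁻¹ m) (m≤m+n m m))

  log-power : ∀ n → 1 ≤ n → suc ⌈log₂ n ⌉ ^ (m + m) ≤ F * n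
  log-power n 1≤n = begin
    suc ⌈log₂ n ⌉ ^ (m + m)            ≤⟨ [1+l]^m≤m^m*2^l (m + m) ⌈log₂ n ⌉ ⟩
    (m + m) ^ (m + m) * 2 ^ ⌈log₂ n ⌉  ≤⟨ *-monoʳ-≤ ((m + m) ^ (m + m)) (2^⌈log₂n⌉≤2n n 1≤n) ⟩
    (m + m) ^ (m + m) * (2 * n)        ≡⟨ regroup ((m + m) ^ (m + m)) n ⟩
    F * n                              ∎
    where
    open ≤-Reasoning
    regroup : ∀ x n → x * (2 * n) ≡ 2 * x * n
    regroup = solve-∀

  total-power : ∀ {b t} → 1 ≤ b → t ^ q ≤ C ^ q * b ^ m → (5 * b + t) ^ q ≤ E * b ^ m
  total-power {b} {t} 1≤b t≤ = begin
    (5 * b + t) ^ q                            ≤⟨ [x+y]^k≤2^k[x^k+y^k] q (5 * b) t ⟩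
    2 ^ q * ((5 * b) ^ q + t ^ q)              ≤⟨ *-monoʳ-≤ (2 ^ q) (+-mono-≤ 5b≤ t≤) ⟩
    2 ^ q * (5 ^ q * b ^ m + C ^ q * b ^ m)    ≡⟨ regroup (2 ^ q) (5 ^ q) (C ^ q) (b ^ m) ⟩
    E * b ^ m                                  ∎
    where
    open ≤-Reasoning
    regroup : ∀ x y z w → x * (y * w + z * w) ≡ x * (y + z) * w
    regroup = solve-∀
    5b≤ : (5 * b) ^ q ≤ 5 ^ q * b ^ m
    5b≤ = ≤-trans (≤-reflexive (^-distribʳ-* q 5 b))
      (*-monoʳ-≤ (5 ^ q) (^-monoʳ-≤ b {{>-nonZero 1≤b}} (m≤n+m q q′)))

  -- After squaring, `n ^ (m + m)` falls short of `n ^ (2 * (q + q))` by two factors `n`. One pays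
  -- for the power `m + m` of the logarithm, by `log-power`; the other is the gain `n ^ 1`, which
  -- means ε = 1 / (2q).
  total-time : ∀ {n b t} → 1 ≤ n → 1 ≤ b → b ≤ 36 * c * (n * suc ⌈log₂ n ⌉) → t ^ q ≤ C ^ q * b ^ m →
               (5 * b + t) ^ (q + q) * n ^ 1 ≤ (K * n ^ 2) ^ (q + q)
  total-time {n} {b} {t} 1≤n 1≤b b≤ t≤ = begin
    S ^ (q + q) * n ^ 1                                        ≡⟨ cong (_* n ^ 1) (^-distribˡ-+-* S q q) ⟩
    S ^ q * S ^ q * n ^ 1                                      ≤⟨ *-monoˡ-≤ (n ^ 1) (*-mono-≤ S≤ S≤) ⟩
    E * b ^ m * (E * b ^ m) * n ^ 1                            ≡⟨ regroup₁ E (b ^ m) n ⟩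
    E * E * (b ^ m * b ^ m) * n                                ≡⟨ cong (λ x → E * E * x * n) (sym (^-distribˡ-+-* b m m)) ⟩
    E * E * b ^ (m + m) * n                                    ≤⟨ *-monoˡ-≤ n (*-monoʳ-≤ (E * E) (^-monoˡ-≤ (m + m) b≤)) ⟩
    E * E * (36 * c * (n * L)) ^ (m + m) * n                   ≡⟨ cong (λ x → E * E * x * n) (trans (^-distribʳ-* (m + m) (36 * c) (n * L)) (cong ((36 * c) ^ (m + m) *_) (^-distribʳ-* (m + m) n L))) ⟩
    E * E * ((36 * c) ^ (m + m) * (n ^ (m + m) * L ^ (m + m))) * n  ≤⟨ *-monoˡ-≤ n (*-monoʳ-≤ (E * E) (*-monoʳ-≤ ((36 * c) ^ (m + m)) (*-monoʳ-≤ (n ^ (m + m)) (log-power n 1≤n)))) ⟩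
    E * E * ((36 * c) ^ (m + m) * (n ^ (m + m) * (F * n))) * n ≡⟨ regroup₂ (E * E) ((36 * c) ^ (m + m)) (n ^ (m + m)) F n ⟩
    K * n ^ (2 + (m + m))                                      ≡⟨ cong (λ k → K * n ^ k) (exponent q′) ⟩
    K * n ^ (2 * (q + q))                                      ≡⟨ cong (K *_) (sym (^-*-assoc n 2 (q + q))) ⟩
    -- In `TimeBound` the constant stands inside the power.
    K * (n ^ 2) ^ (q + q)                                      ≤⟨ *-monoˡ-≤ ((n ^ 2) ^ (q + q)) (x≤x^[1+k] K (q′ + q)) ⟩
    K ^ (q + q) * (n ^ 2) ^ (q + q)                            ≡⟨ sym (^-distribʳ-* (q + q) K (n ^ 2)) ⟩
    (K * n ^ 2) ^ (q + q)                                      ∎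
    where
    open ≤-Reasoning
    S L : ℕ
    S = 5 * b + t
    L = suc ⌈log₂ n ⌉
    S≤ : S ^ q ≤ E * b ^ m
    S≤ = total-power 1≤b t≤
    regroup₁ : ∀ x y n → x * y * (x * y) * (n * 1) ≡ x * x * (y * y) * n
    regroup₁ = solve-∀
    regroup₂ : ∀ x y z f n → x * (y * (z * (f * n))) * n ≡ x * y * f * (n * (n * z))
    regroup₂ = solve-∀
    exponent : ∀ q′ → 2 + ((q′ + suc q′) + (q′ + suc q′)) ≡ 2 * (suc q′ + suc q′)
    exponent = solve-∀

  -- Weakens the time bound from ε = p / q to 1 / q.
  divide-by-size : ∀ {N b t} p → 1 ≤ N → N ≤ b → t ^ q * N ^ suc p ≤ (C * N ^ 2) ^ q → t ^ q ≤ C ^ q * b ^ m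
  divide-by-size {N} {b} {t} p 1≤N N≤b t≤ = *-cancelʳ-≤ (t ^ q) (C ^ q * b ^ m) N (begin
    t ^ q * N                  ≤⟨ *-monoʳ-≤ (t ^ q) (m≤m*n N (N ^ p) {{m^n≢0 N p}}) ⟩
    t ^ q * N ^ suc p          ≤⟨ t≤ ⟩
    (C * N ^ 2) ^ q            ≡⟨ ^-distribʳ-* q C (N ^ 2) ⟩
    C ^ q * (N ^ 2) ^ q        ≡⟨ cong (C ^ q *_) (trans (^-*-assoc N 2 q) (cong (N ^_) (exponent q′))) ⟩
    C ^ q * N ^ suc m          ≡⟨ regroup (C ^ q) N (N ^ m) ⟩
    C ^ q * N ^ m * N          ≤⟨ *-monoˡ-≤ N (*-monoʳ-≤ (C ^ q) (^-monoˡ-≤ m N≤b)) ⟩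
    C ^ q * b ^ m * N          ∎)
    where
    open ≤-Reasoning
    instance
      N-nonZero : NonZero N
      N-nonZero = >-nonZero 1≤N
    exponent : ∀ q′ → 2 * suc q′ ≡ suc (q′ + suc q′)
    exponent = solve-∀
    regroup : ∀ x n y → x * (n * y) ≡ x * y * n
    regroup = solve-∀

reductionBound-word : ∀ n c → 1 ≤ n → 1 ≤ c → reductionBound n (c * ⌈log₂ n ⌉) < 2 ^ ((8 + c) * suc ⌈log₂ n ⌉)
reductionBound-word n c 1≤n 1≤c = begin-strict
  reductionBound n (c * l)          ≤⟨ reductionBound-≤ l 1≤n 1≤c ⟩
  -- The first comparison is 36 < 37 + 27 = 2 ^ 6.
  36 * c * (n * L)                  <⟨ *-mono-< (*-mono-< (m≤m+n 37 27) (n<2^n c)) (*-mono-< n< (n<2^n L)) ⟩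
  2 ^ 6 * 2 ^ c * (2 ^ L * 2 ^ L)   ≡⟨ cong₂ _*_ (sym (^-distribˡ-+-* 2 6 c)) (sym (^-distribˡ-+-* 2 L L)) ⟩
  2 ^ (6 + c) * 2 ^ (L + L)         ≡⟨ sym (^-distribˡ-+-* 2 (6 + c) (L + L)) ⟩
  2 ^ (6 + c + (L + L))             ≤⟨ ^-monoʳ-≤ 2 exponent ⟩
  2 ^ ((8 + c) * L)                 ∎
  where
  open ≤-Reasoning
  l L : ℕ
  l = ⌈log₂ n ⌉
  L = suc l
  n< : n < 2 ^ L
  n< = ≤-<-trans (n≤2^⌈log₂n⌉ n) (^-monoʳ-< 2 ≤-refl (n<1+n l))
  exponent : 6 + c + (L + L) ≤ (8 + c) * L
  exponent = ≤-trans (m≤m+n (6 + c + (L + L)) ((6 + c) * l)) (≤-reflexive (arithmetic c l))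
    where
    arithmetic : ∀ c l → 6 + c + (suc l + suc l) + (6 + c) * l ≡ (8 + c) * suc l
    arithmetic = solve-∀

-- The reduction

18≤reductionBound : ∀ n d → 18 ≤ reductionBound n d
18≤reductionBound n d = ≤-trans (m≤m*n 18 (suc n * suc d)) (≤-reflexive (sym (reductionBound≡ n d)))

-- The universe is empty for `n = 1`, where the logarithm vanishes. The graph would then have no
-- leaves and the second list would be cut off; but no sets meet, and register 0 already holds the
-- answer 0.
reduction : Program → Program
reduction P = block readHeader
  ⨾ (if≢0 toℕ {#regs} dʳ then (buildGraph ⨾ shift #regs P ⨾ arith 0 less #regs (toℕ {#regs} thresholdʳ)) else skip)

Hitting : ∀ {n d} → Vec (Subset d) n → Vec (Subset d) n → Set
Hitting A B = Vec.Any (λ a → Vec.All (λ b → Nonempty (a ∩ b)) B) A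

Decides : Set → ℕ → Set
Decides P x = (P × x ≡ 1) ⊎ (¬ P × x ≡ 0)

sparseGraph : ∀ {n e} (A B : Vec (Subset (suc e)) n) → 1 ≤ n → SparseGraph 2
sparseGraph {n} {e} A B 1≤n = record
  { n = N
  ; graph = graph
  ; connected = connected (fromℕ< 1≤n)
  ; sparse = ≤-trans (≤-reflexive length-edges) (slack (6 + 3 * d + n + (3 * d + n + (3 * d + n))) (arithmetic n d))
  }
  where
  open Encoding n e A B
  arithmetic : ∀ n d → let M = 3 * d + n + n * d in
    (n + n) * d + 3 * d + n + n + n + M + M + (6 + 3 * d + n + (3 * d + n + (3 * d + n)))
      ≡ 2 * (3 + (3 * d + ((n + n) + 2 * M)))
  arithmetic = solve-∀

module _ {n e : ℕ} (A B : Vec (Subset (suc e)) n) where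

  open Encoding n e A B

  hits⇒Hitting : ∃ Hits → Hitting A B
  hits⇒Hitting (i , hits) = any⁺ A i (VecAll.lookup⁻ hits)
    where
    any⁺ : ∀ {n} {Q : Subset d → Set} (A : Vec (Subset d) n) i → Q (lookup A i) → Vec.Any Q A
    any⁺ (a ∷ A) zero q = Vec.here q
    any⁺ (a ∷ A) (suc i) q = Vec.there (any⁺ A i q)

  Hitting⇒hits : Hitting A B → ∃ Hits
  Hitting⇒hits hit = Vec.index hit , VecAll.lookup⁺ (VecAny.lookup-index hit)

  decides : ∀ {x} → Graph.IsMedianValue graph x → Decides (Hitting A B) (if x <ᵇ threshold then 1 else 0)
  decides {x} isMedian = by (x <ᵇ threshold) (<ᵇ⇒< x threshold) (<⇒<ᵇ {x} {threshold})
    where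
    by : ∀ b → (T b → x < threshold) → (x < threshold → T b) → Decides (Hitting A B) (if b then 1 else 0)
    by true  x< _ = inj₁ (hits⇒Hitting (median<⇒hits isMedian (x< tt)) , refl)
    by false _ x≮ = inj₂ ((λ hit → x≮ (hits⇒median< isMedian (Hitting⇒hits hit))) , refl)

-- `Fast` stands for the time bound of the median program, so that runs are combined without looking
-- into powers. `Fast 0` serves the empty universe, where that program is never called.
module _ {w : ℕ} {P : Program} (Fast : ℕ → Set) (fast-0 : Fast 0) where

  MedianRun : SparseGraph 2 → Set
  MedianRun G = ∃[ u ] ∃[ τ ] Exec w P (initial (Problem.encode (Median 2) G)) u τ
    × SparseGraph.IsMedianValue G (output τ) × Fast u

  HittingRun : ∀ {n d} → Vec (Subset d) n → Vec (Subset d) n → Set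
  HittingRun {n} {d} A B = ∃[ t ] ∃[ τ ] Exec w (reduction P) (initial (n ∷ d ∷ bits A ++ bits B)) t τ
    × Decides (Hitting A B) (output τ) × ∃[ u ] t ≤ 5 * reductionBound n d + u × Fast u

  run-readHeader : ∀ {n d} (A B : Vec (Subset d) n) → reductionBound n d < 2 ^ w →
    let m = contents (n ∷ d ∷ bits A ++ bits B) in
    Runs w (block readHeader) 4
      (λ vs m′ → vs ≡ 0 ∷ n ∷ d ∷ 1 ∷ 0 ∷ 0 ∷ 0 ∷ 0 ∷ 0 ∷ 0 ∷ 0 ∷ 0 ∷ 0 ∷ 0 ∷ 0 ∷ 0 ∷ [] × m′ ≡ m)
      (Vec.replicate #regs 0) m
  run-readHeader {n} {d} A B bound< = run-block readHeader
    (header< (≤-trans (n≤1+n n) (m≤m*n (suc n) (suc d))) , header< (s≤s z≤n)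
    , header< (≤-trans (n≤1+n d) (m≤n*m (suc d) (suc n))) , refl , refl)
    where
    header< : ∀ {x} → x ≤ suc n * suc d → x < 2 ^ w
    header< x≤ = ≤-<-trans (≤-trans x≤ (≤-trans (m≤n*m (suc n * suc d) 18) (≤-reflexive (sym (reductionBound≡ n d))))) bound<

  -- The output register 0 of the renamed program is register `#regs`, and the threshold has
  -- survived in register 15, the last one out of its reach.
  run-compare : ∀ {vs m σ xs T u ρ} → Represents vs m σ → lookup vs thresholdʳ ≡ T → m ≗ contents xs →
    Exec w P (initial xs) u ρ → 1 < 2 ^ w →
    ∃[ τ ] Exec w (shift #regs P ⨾ arith 0 less #regs (toℕ {#regs} thresholdʳ)) σ (u + 1) τ
         × output τ ≡ (if output ρ <ᵇ T then 1 else 0)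
  run-compare {σ = σ} {T = T} {ρ = ρ} rep refl m≗ ex 1<
    with shift-Exec {s = #regs} σ ex (record { regs = high rep ; mems = λ i → trans (cong (λ m → m i) (mem≡ rep)) (m≗ i) })
  ... | σ′ , ex′ , shifted , same =
    _ , seq ex′ (arith (subst (_< 2 ^ w) (sym result) (≤-<-trans (bitValue≤1 (output ρ <ᵇ T)) 1<))) , result
    where
    result : ⟦ less ⟧ (reg σ′ #regs) (reg σ′ 15) ≡ (if output ρ <ᵇ T then 1 else 0)
    result = cong₂ (λ a b → if a <ᵇ b then 1 else 0) (Shifted.regs shifted 0)
      (trans (sym (same 15 ≤-refl)) (low rep thresholdʳ))

  run-nonempty : ∀ {n e} (A B : Vec (Subset (suc e)) n) (1≤n : 1 ≤ n) → reductionBound n (suc e) < 2 ^ w →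
    MedianRun (sparseGraph A B 1≤n) → HittingRun A B
  run-nonempty {n} {e} A B 1≤n bound< (u , ρ , exP , isMedian , fast) =
    afterHeader (run-readHeader A B bound< (initial input) (initial-represents input))
    where
    open Encoding n e A B

    b : ℕ
    b = reductionBound n d

    regs₁ : Regs
    regs₁ = initialRegs n e A B

    BuiltFrom : State → Set
    BuiltFrom σ = ∃[ t ] ∃[ τ ] Exec w buildGraph σ t τ × t ≤ buildTime n e A B ×
      ∃[ vs ] ∃[ m ] Represents vs m τ × Built n e A B vs m

    -- Header, branch and comparison take 4 + 1 + 1 steps, which a fifth `b` covers.
    time≤ : ∀ {t₀ t₁} → t₀ ≤ 4 → t₁ ≤ buildTime n e A B → t₀ + suc (t₁ + (u + 1)) ≤ 5 * b + u
    time≤ {t₀} {t₁} t₀≤ t₁≤ = begin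
      t₀ + suc (t₁ + (u + 1))     ≤⟨ +-mono-≤ t₀≤ (s≤s (+-monoˡ-≤ (u + 1) (≤-trans t₁≤ (buildTime≤ n e A B)))) ⟩
      4 + suc (4 * b + (u + 1))   ≡⟨ regroup₁ b u ⟩
      6 + (4 * b + u)             ≤⟨ +-monoˡ-≤ (4 * b + u) (≤-trans (m≤m+n 6 12) (18≤reductionBound n d)) ⟩
      b + (4 * b + u)             ≡⟨ regroup₂ b u ⟩
      5 * b + u                   ∎
      where
      open ≤-Reasoning
      regroup₁ : ∀ b u → 4 + suc (4 * b + (u + 1)) ≡ 6 + (4 * b + u)
      regroup₁ = solve-∀
      regroup₂ : ∀ b u → b + (4 * b + u) ≡ 5 * b + u
      regroup₂ = solve-∀

    afterBuild : ∀ {t₀ σ₀ m₀} → Exec w (block readHeader) (initial input) t₀ σ₀ → t₀ ≤ 4 → Represents regs₁ m₀ σ₀ →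
                 BuiltFrom σ₀ → HittingRun A B
    afterBuild ex₀ t₀≤ rep₀ (t₁ , σ₁ , ex₁ , t₁≤ , vs , m , rep₁ , threshold-reg , m≗)
      with run-compare {xs = encoding} rep₁ threshold-reg m≗ exP (≤-<-trans (≤-trans (m≤m+n 1 17) (18≤reductionBound n d)) bound<)
    ... | τ , ex₂ , out =
      _ , τ , seq ex₀ (if-nonzero (λ z → 1+n≢0 (trans (sym (low rep₀ dʳ)) z)) (seq ex₁ ex₂))
      , subst (Decides (Hitting A B)) (sym out) (decides A B isMedian) , u , time≤ t₀≤ t₁≤ , fast

    afterHeader : (∃[ t ] ∃[ τ ] Exec w (block readHeader) (initial input) t τ × t ≤ 4 ×
                    ∃[ vs ] ∃[ m ] Represents vs m τ × vs ≡ regs₁ × m ≡ contents input) → HittingRun A B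
    afterHeader (t₀ , σ₀ , ex₀ , t₀≤ , _ , _ , rep₀ , refl , refl) =
      afterBuild ex₀ t₀≤ rep₀ (run-buildGraph n e A B {w} bound< σ₀ rep₀)

  run-empty : ∀ {n} (A B : Vec (Subset 0) n) → 1 ≤ n → reductionBound n 0 < 2 ^ w → HittingRun A B
  run-empty {n} A B 1≤n bound< =
    afterHeader (run-readHeader A B bound< (initial input) (initial-represents input))
    where
    input : List ℕ
    input = n ∷ 0 ∷ bits A ++ bits B

    unhittable : ∀ {n} (A B : Vec (Subset 0) n) → 1 ≤ n → ¬ Hitting A B
    unhittable A (b ∷ B) _ hit with VecAny.lookup-index hit
    ... | (() , _) Vec.∷ _

    b : ℕ
    b = reductionBound n 0

    time≤ : ∀ {t} → t ≤ 4 → t + 2 ≤ 5 * b + 0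
    time≤ {t} t≤ = begin
      t + 2      ≤⟨ +-monoˡ-≤ 2 t≤ ⟩
      6          ≤⟨ m≤m+n 6 12 ⟩
      18         ≤⟨ 18≤reductionBound n 0 ⟩
      b          ≤⟨ m≤n*m b 5 ⟩
      5 * b      ≤⟨ m≤m+n (5 * b) 0 ⟩
      5 * b + 0  ∎
      where open ≤-Reasoning

    afterHeader : (∃[ t ] ∃[ τ ] Exec w (block readHeader) (initial input) t τ × t ≤ 4 ×
                    ∃[ vs ] ∃[ m ] Represents vs m τ
                      × vs ≡ 0 ∷ n ∷ 0 ∷ 1 ∷ 0 ∷ 0 ∷ 0 ∷ 0 ∷ 0 ∷ 0 ∷ 0 ∷ 0 ∷ 0 ∷ 0 ∷ 0 ∷ 0 ∷ [] × m ≡ contents input) →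
                  HittingRun A B
    afterHeader (t , τ , ex , t≤ , _ , _ , rep , refl , _) =
      t + 2 , τ , seq ex (if-zero (low rep dʳ) skip) , inj₂ (unhittable A B 1≤n , low rep zeroʳ)
      , 0 , time≤ t≤ , fast-0

  reduction-correct : ∀ {n d} (A B : Vec (Subset d) n) → 1 ≤ n → reductionBound n d < 2 ^ w →
    (∀ G → 1 ≤ SparseGraph.n G → SparseGraph.n G ≤ reductionBound n d → MedianRun G) → HittingRun A B
  reduction-correct {d = zero} A B 1≤n bound< _ = run-empty A B 1≤n bound<
  reduction-correct {n} {suc e} A B 1≤n bound< median =
    run-nonempty A B 1≤n bound< (median (sparseGraph A B 1≤n) (s≤s z≤n) (N≤bound n e A B))

numerator-suc : ∀ {ε} → 0ℚ <ℚ ε → ∃[ p ] ℤ.∣ ↥ ε ∣ ≡ suc p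
numerator-suc {mkℚ (ℤ.+ suc p) _ _} _ = p , refl
numerator-suc {mkℚ (ℤ.+ zero) _ _} (*<* (ℤ.+<+ ()))
numerator-suc {mkℚ ℤ.-[1+ p ] _ _} _ = p , refl

abstract
  -- By `reductionBound-word`, `8 + c` times `suc` of the logarithm is enough bits for every number
  -- of the construction. It thus also bounds the logarithm of the number of vertices, of which the
  -- median program wants `k` times the successor; `9` makes room for that successor, and `suc k`
  -- keeps the factor positive.
  wordFactor : (k c : ℕ) → ℕ
  wordFactor k c = suc k * (9 + c)

  timeFactor : (q′ C c : ℕ) → ℕ
  timeFactor = Exponents.K

  reductionBound-fits : ∀ {n c} k → 1 ≤ n → 1 ≤ c → reductionBound n (c * ⌈log₂ n ⌉) < 2 ^ (wordFactor k c * suc ⌈log₂ n ⌉)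
  reductionBound-fits {n} {c} k 1≤n 1≤c = <-≤-trans (reductionBound-word n c 1≤n 1≤c)
    (^-monoʳ-≤ 2 (*-monoˡ-≤ (suc ⌈log₂ n ⌉) (≤-trans (n≤1+n (8 + c)) (m≤n*m (9 + c) (suc k)))))

  medianWord-≤ : ∀ {n c N} k → 1 ≤ n → 1 ≤ c → N ≤ reductionBound n (c * ⌈log₂ n ⌉) →
                 k * suc ⌈log₂ N ⌉ ≤ wordFactor k c * suc ⌈log₂ n ⌉
  medianWord-≤ {n} {c} {N} k 1≤n 1≤c N≤ = begin
    k * suc ⌈log₂ N ⌉            ≤⟨ *-mono-≤ (n≤1+n k) (s≤s log≤) ⟩
    suc k * suc ((8 + c) * L)    ≤⟨ *-monoʳ-≤ (suc k) (+-monoˡ-≤ ((8 + c) * L) (s≤s z≤n)) ⟩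
    suc k * ((9 + c) * L)        ≡⟨ sym (*-assoc (suc k) (9 + c) L) ⟩
    suc k * (9 + c) * L          ∎
    where
    open ≤-Reasoning
    L : ℕ
    L = suc ⌈log₂ n ⌉
    log≤ : ⌈log₂ N ⌉ ≤ (8 + c) * L
    log≤ = ≤-trans (⌈log₂⌉-mono-≤ (≤-trans N≤ (<⇒≤ (reductionBound-word n c 1≤n 1≤c))))
                   (≤-reflexive (⌈log₂2^n⌉≡n ((8 + c) * L)))

  reduction-time : ∀ q′ C c {n t u} → 1 ≤ n → 1 ≤ c → let b = reductionBound n (c * ⌈log₂ n ⌉) in
    t ≤ 5 * b + u → u ^ suc q′ ≤ C ^ suc q′ * b ^ (q′ + suc q′) →
    t ^ (suc q′ + suc q′) * n ^ 1 ≤ (timeFactor q′ C c * n ^ 2) ^ (suc q′ + suc q′)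
  reduction-time q′ C c {n} 1≤n 1≤c t≤ u≤ = ≤-trans (*-monoˡ-≤ (n ^ 1) (^-monoˡ-≤ (suc q′ + suc q′) t≤))
    (Exponents.total-time q′ C c 1≤n (≤-trans (m≤m+n 1 17) (18≤reductionBound n (c * ⌈log₂ n ⌉)))
      (reductionBound-≤ ⌈log₂ n ⌉ 1≤n 1≤c) u≤)

MedianSolver : (P : Program) (k C q p : ℕ) → Set
MedianSolver P k C q p = ∀ G → let N = SparseGraph.n G in 1 ≤ N → ∃[ t ] ∃[ τ ]
  Exec (k * suc ⌈log₂ N ⌉) P (initial (Problem.encode (Median 2) G)) t τ
  × SparseGraph.IsMedianValue G (output τ) × t ^ q * N ^ p ≤ (C * N ^ 2) ^ q

solveHittingSet : ∀ {P k C q′ p c n} → MedianSolver P k C (suc q′) (suc p) → 1 ≤ c → 1 ≤ n →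
  (A B : Vec (Subset (c * ⌈log₂ n ⌉)) n) → ∃[ t ] ∃[ τ ]
  Exec (wordFactor k c * suc ⌈log₂ n ⌉) (reduction P) (initial (n ∷ c * ⌈log₂ n ⌉ ∷ bits A ++ bits B)) t τ
  × Decides (Hitting A B) (output τ)
  × t ^ (suc q′ + suc q′) * n ^ 1 ≤ (timeFactor q′ C c * n ^ 2) ^ (suc q′ + suc q′)
solveHittingSet {P} {k} {C} {q′} {p} {c} {n} solve 1≤c 1≤n A B =
  conclude (reduction-correct Fast z≤n A B 1≤n (reductionBound-fits k 1≤n 1≤c) medianRun)
  where
  w : ℕ
  w = wordFactor k c * suc ⌈log₂ n ⌉

  Fast : ℕ → Set
  Fast u = u ^ suc q′ ≤ C ^ suc q′ * reductionBound n (c * ⌈log₂ n ⌉) ^ (q′ + suc q′)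

  medianRun : ∀ G → 1 ≤ SparseGraph.n G → SparseGraph.n G ≤ reductionBound n (c * ⌈log₂ n ⌉) →
              MedianRun {w} {P} Fast z≤n G
  medianRun G 1≤N N≤ with solve G 1≤N
  ... | t , τ , ex , isMedian , t≤ = t , τ , Exec-weaken (medianWord-≤ k 1≤n 1≤c N≤) ex , isMedian
    , Exponents.divide-by-size q′ C c {t = t} p 1≤N N≤ t≤

  conclude : HittingRun {w} {P} Fast z≤n A B → _
  conclude (t , τ , ex , answer , u , t≤ , fast) = t , τ , ex , answer , reduction-time q′ C c 1≤n 1≤c t≤ fast

theorem1p10 : SubquadraticSparseMedian → ¬ HittingSetConjecture
-- By `sparseGraph` the graphs have at most two edges per vertex.
theorem1p10 median refute with median 2
... | ε@(mkℚ _ q′ _) , 0<ε , P , k , C , solve with numerator-suc 0<ε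
... | p , p≡ = refute (ε′ , *<* (ℤ.+<+ (s≤s z≤n)) , λ c 1≤c → reduction P , wordFactor k c , timeFactor q′ C c ,
                 λ I 1≤n → solveHittingSet {p = p} solve′ 1≤c 1≤n (SetLists.A I) (SetLists.B I))
  where
  ε′ : ℚ
  -- This is 1 / (2q), half of what remains of p / q after weakening it to 1 / q; `mkℚ` stores the
  -- denominator minus one.
  ε′ = mkℚ (ℤ.+ 1) (q′ + suc q′) (1-coprimeTo _)

  solve′ : MedianSolver P k C (suc q′) (suc p)
  solve′ G 1≤N with solve G 1≤N
  ... | t , τ , ex , isMedian , t≤ =
    t , τ , ex , isMedian , subst (λ p → t ^ suc q′ * SparseGraph.n G ^ p ≤ (C * SparseGraph.n G ^ 2) ^ suc q′) p≡ t≤
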